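{- Let $h$ be the morphism on $\{0,1,2\}^*$ defined by $h(0)=01$, $h(1)=21$, $h(2)=0$, and let $\mathbf{p}=\mathbf{p}[0]\mathbf{p}[1]\cdots$ be the infinite fixed point of $h$ beginning with $0$. For $i\geq 0$ define $B_{2i+3}=[1(01)^i10]_P$, $B_{2i+4}=[1(01)^i100]_P$, $C_{4i+2}=[10(0010)^i]_P$, $C_{4i+3}=[10(0010)^i0]_P$, $C_{4i+4}=[10(0010)^i00]_P$, $C_{4i+5}=[10(0010)^i001]_P$. Then the recurrence function $R$ of $\mathbf{p}$ satisfies $R(1)=5$, $R(2)=12$, $R(3)=16$, $R(4)=21$, $R(5)=28$, and for every $i\geq 3$: $R(n)=X_{i+4}$ if $B_i\leq n\leq C_{i+1}$, and $R(n)=X_{i+4}+X_{i+2}$ if $C_{i+1}<n<B_{i+1}$.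
   Context: Define $X_1=1$, $X_2=2$, $X_3=4$, $X_4=7$, and $X_n=X_{n-1}+X_{n-2}+X_{n-4}$ for $n\geq 5$ (so $X_n=1,2,4,7,12,21,37,65,\dots$). For a binary word $w=e_t\cdots e_1$, $[w]_P=\sum_{i=1}^t e_iX_i$. The recurrence function $R(n)$ is the smallest positive integer $m$ such that for every position $i\ge 0$ there is a position $j$ with $i<j\leq i+m$ and $\mathbf{p}[j..j+n-1]=\mathbf{p}[i..i+n-1]$ (every occurrence of a length-$n$ factor is followed by another occurrence of it at distance at most $m$). -}

module Defs where

open import Data.Nat using (ℕ; zero; suc; _+_; _*_; _∸_; _≤_; _<_)
open import Data.Nat.DivMod using (_/_; _%_)
open import Data.Fin using (Fin)
open import Data.List using (List; []; _∷_; _++_; concatMap; length; replicate; concat)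
open import Data.Product using (_×_; ∃)
open import Relation.Binary.PropositionalEquality using (_≡_)
open import Relation.Nullary using (¬_)

Letter : Set
Letter = Fin 3

hL : Letter → List Letter
hL Fin.zero = Fin.zero ∷ Fin.suc Fin.zero ∷ []
hL (Fin.suc Fin.zero) = Fin.suc (Fin.suc Fin.zero) ∷ Fin.suc Fin.zero ∷ []
hL (Fin.suc (Fin.suc Fin.zero)) = Fin.zero ∷ []

h : List Letter → List Letter
h = concatMap hL

hIter : ℕ → List Letter
hIter zero = Fin.zero ∷ []
hIter (suc k) = h (hIter k)

nth : {A : Set} → A → List A → ℕ → A
nth d [] _ = d
nth d (x ∷ xs) zero = x
nth d (x ∷ xs) (suc k) = nth d xs k

-- the fixed point p of h beginning with 0: p[k] is the k-th letter of h^(k+1)(0)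
-- (h^m(0) is a prefix of h^(m+1)(0) and |h^(k+1)(0)| > k)
p : ℕ → Letter
p k = nth Fin.zero (hIter (suc k)) k

-- X_1 = 1, X_2 = 2, X_3 = 4, X_4 = 7, X_n = X_{n-1} + X_{n-2} + X_{n-4} (n ≥ 5); X_0 unused (set to 0)
X : ℕ → ℕ
X 0 = 0
X 1 = 1
X 2 = 2
X 3 = 4
X 4 = 7
X (suc (suc (suc (suc (suc n))))) =
  X (suc (suc (suc (suc n)))) + X (suc (suc (suc n))) + X (suc n)

-- [e_t ⋯ e_1]_P = Σ e_i X_i ; the list is written most significant digit first
valP : List ℕ → ℕ
valP [] = 0
valP (e ∷ w) = e * X (suc (length w)) + valP w

rep : ℕ → List ℕ → List ℕ
rep i w = concat (replicate i w)

Bodd : ℕ → List ℕ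
Bodd i = 1 ∷ rep i (0 ∷ 1 ∷ []) ++ (1 ∷ 0 ∷ [])

Beven : ℕ → List ℕ
Beven i = Bodd i ++ (0 ∷ [])

Bsel : ℕ → ℕ → ℕ
Bsel 0 n = valP (Beven ((n ∸ 4) / 2))
Bsel _ n = valP (Bodd ((n ∸ 3) / 2))

-- B n, meaningful for n ≥ 3
B : ℕ → ℕ
B n = Bsel (n % 2) n

Ctail : ℕ → List ℕ
Ctail 0 = []
Ctail 1 = 0 ∷ []
Ctail 2 = 0 ∷ 0 ∷ []
Ctail _ = 0 ∷ 0 ∷ 1 ∷ []

-- C n, meaningful for n ≥ 2
C : ℕ → ℕ
C n = valP (1 ∷ 0 ∷ rep ((n ∸ 2) / 4) (0 ∷ 0 ∷ 1 ∷ 0 ∷ []) ++ Ctail ((n ∸ 2) % 4))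

Recurrent : ℕ → ℕ → Set
Recurrent n m = ∀ i → ∃ λ j → i < j × j ≤ i + m × (∀ k → k < n → p (j + k) ≡ p (i + k))

IsR : ℕ → ℕ → Set
IsR n m = 1 ≤ m × Recurrent n m × (∀ m' → 1 ≤ m' → m' < m → ¬ Recurrent n m')

{-# OPTIONS --safe #-}
module Submission where

-- Every factor w of p can be desubstituted: its occurrences correspond, through the block decomposition
-- p = h(p[0]) h(p[1]) ⋯, to those of a shorter factor. A common factor whose two left (right) neighbours lie
-- in a fixed pair of letters extends after applying h by a forced letter or not at all, and the pairs alternate.
-- Thus the bispecial words 1 and 10 generate two families of bispecial words, of lengths C(k+2) - 1 and B(k+2) - 2
-- (k ≥ 1 for B), and R increases when a window first contains such a word together with both its neighbours.
--
-- Upper bound: cover p by maximal intervals that recur within the required distance. Consecutive intervals overlap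
-- in words at least as long as the k-th bispecial word, so every window one letter longer lies in one interval.
-- For k = 0 this is a finite check on the factors of length 22, and everything lifts along h^k, where the distance
-- becomes |h^k(u)| for a return word u, which depends only on the Parikh vector of u.
--
-- Lower bound: 2102 (at positions 2 and 23) and 010 (at positions 16 and 32) have return words with the Parikh
-- vectors of h⁵(0) and h⁴(0)h²(0), and desubstitution carries consecutive occurrences to consecutive occurrences.

open import Defs
open import Data.Nat using (ℕ; zero; suc; _+_; _∸_; _*_; _≤_; _<_; z≤n; s≤s; s≤s⁻¹; _≤?_; _<?_)
open import Data.Nat.Properties
open import Data.Nat.DivMod using (_/_; _%_; [m+kn]%n≡m%n; m*n/n≡m; m%n<n; m≡m%n+[m/n]*n)
open import Data.Nat.Induction using (<-rec)
open import Data.Nat.Tactic.RingSolver using (solve-∀)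
open import Data.Fin using (Fin)
import Data.Fin.Properties as Fin
open import Data.List using (List; []; _∷_; _++_; length; take; drop; upTo; deduplicate; map)
open import Data.List.Properties using (++-assoc; length-++; concatMap-++; ≡-dec; take++drop≡id; length-take)
open import Data.Product using (_×_; _,_; ∃; ∃₂; proj₁; proj₂)
open import Data.Sum using (_⊎_; inj₁; inj₂)
open import Data.Unit using (⊤; tt)
open import Data.Empty using (⊥; ⊥-elim)
open import Data.List.Membership.Propositional using (_∈_)
open import Data.List.Membership.DecPropositional (≡-dec (Fin._≟_ {3})) using (_∈?_)
open import Data.List.Relation.Unary.All using (All; all?; []; _∷_) renaming (lookup to All-lookup)
open import Data.List.Relation.Unary.Any using (Any; any?; satisfied)
open import Relation.Nullary using (¬_; Dec; yes; no)
open import Relation.Nullary.Decidable using (from-yes; True; toWitness; ¬?; _×-dec_; _→-dec_)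
open import Relation.Binary.PropositionalEquality

pattern l0 = Fin.zero
pattern l1 = Fin.suc Fin.zero
pattern l2 = Fin.suc (Fin.suc Fin.zero)

-- Occurrences of words in p

Word : Set
Word = List Letter

Occ : Word → ℕ → Set
Occ [] x = ⊤
Occ (a ∷ w) x = p x ≡ a × Occ w (suc x)

Occ-++ˡ : ∀ u {v x} → Occ (u ++ v) x → Occ u x
Occ-++ˡ [] _ = tt
Occ-++ˡ (a ∷ u) (e , o) = e , Occ-++ˡ u o

Occ-++ʳ : ∀ u {v x} → Occ (u ++ v) x → Occ v (x + length u)
Occ-++ʳ [] {v} {x} o = subst (Occ v) (sym (+-identityʳ x)) o
Occ-++ʳ (a ∷ u) {v} {x} (_ , o) = subst (Occ v) (sym (+-suc x (length u))) (Occ-++ʳ u o)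

Occ-++ : ∀ u {v x} → Occ u x → Occ v (x + length u) → Occ (u ++ v) x
Occ-++ [] {v} {x} _ o = subst (Occ v) (+-identityʳ x) o
Occ-++ (a ∷ u) {v} {x} (e , o) o′ = e , Occ-++ u o (subst (Occ v) (+-suc x (length u)) o′)

Occ-match : ∀ w {x y} → Occ w x → Occ w y → ∀ k → k < length w → p (y + k) ≡ p (x + k)
Occ-match (a ∷ w) {x} {y} (e , _) (e′ , _) zero _ rewrite +-identityʳ x | +-identityʳ y = trans e′ (sym e)
Occ-match (a ∷ w) {x} {y} (_ , o) (_ , o′) (suc k) (s≤s k<) rewrite +-suc x k | +-suc y k =
  Occ-match w o o′ k k<

match-Occ : ∀ w {x y} → Occ w x → (∀ k → k < length w → p (y + k) ≡ p (x + k)) → Occ w y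
match-Occ [] _ _ = tt
match-Occ (a ∷ w) {x} {y} (e , o) f =
  trans (trans (cong p (sym (+-identityʳ y))) (f 0 (s≤s z≤n))) (trans (cong p (+-identityʳ x)) e) ,
  match-Occ w o (λ k k< → trans (cong p (sym (+-suc y k))) (trans (f (suc k) (s≤s k<)) (cong p (+-suc x k))))

-- The prefixes h^m(0) of p

h-++ : ∀ u v → h (u ++ v) ≡ h u ++ h v
h-++ = concatMap-++ hL

-- The word h^m(1): since h(0) = 01, it is what h^(m+1)(0) appends to h^m(0).
growth : ℕ → Word
growth zero = l1 ∷ []
growth (suc m) = h (growth m)

hIter-suc : ∀ m → hIter (suc m) ≡ hIter m ++ growth m
hIter-suc zero = refl
hIter-suc (suc m) = trans (cong h (hIter-suc m)) (h-++ (hIter m) (growth m))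

length-h : ∀ w → length w ≤ length (h w)
length-h [] = z≤n
length-h (l0 ∷ w) = s≤s (m≤n⇒m≤1+n (length-h w))
length-h (l1 ∷ w) = s≤s (m≤n⇒m≤1+n (length-h w))
length-h (l2 ∷ w) = s≤s (length-h w)

growth-length : ∀ m → 1 ≤ length (growth m)
growth-length zero = s≤s z≤n
growth-length (suc m) = ≤-trans (growth-length m) (length-h (growth m))

hIter-length : ∀ m → m < length (hIter m)
hIter-length zero = s≤s z≤n
hIter-length (suc m) rewrite hIter-suc m | length-++ (hIter m) {growth m} =
  subst (_< length (hIter m) + length (growth m)) (+-comm m 1)
    (+-mono-<-≤ (hIter-length m) (growth-length m))

nth-++ : ∀ {d : Letter} u {v} k → k < length u → nth d (u ++ v) k ≡ nth d u k
nth-++ (a ∷ u) zero _ = refl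
nth-++ (a ∷ u) (suc k) (s≤s k<) = nth-++ u k k<

nth-hIter-+ : ∀ m d k → k < length (hIter m) → nth l0 (hIter (d + m)) k ≡ nth l0 (hIter m) k
nth-hIter-+ m zero k k< = refl
nth-hIter-+ m (suc d) k k< = trans (cong (λ w → nth l0 w k) (hIter-suc (d + m)))
  (trans (nth-++ (hIter (d + m)) k (<-≤-trans k< (mono d))) (nth-hIter-+ m d k k<))
  where
  mono : ∀ d → length (hIter m) ≤ length (hIter (d + m))
  mono zero = ≤-refl
  mono (suc d) rewrite hIter-suc (d + m) | length-++ (hIter (d + m)) {growth (d + m)} =
    ≤-trans (mono d) (m≤m+n _ _)

-- `p k` is read off `hIter (suc k)`; both this word and `hIter m` are prefixes of
-- `hIter (m + suc k)`.
nth-hIter : ∀ m k → k < length (hIter m) → p k ≡ nth l0 (hIter m) k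
nth-hIter m k k< = trans
  (sym (nth-hIter-+ (suc k) m k (<-trans (n<1+n k) (hIter-length (suc k)))))
  (trans (cong (λ d → nth l0 (hIter d) k) (+-comm m (suc k))) (nth-hIter-+ m (suc k) k k<))

nth-Occ : ∀ w x → (∀ k → k < length w → p (x + k) ≡ nth l0 w k) → Occ w x
nth-Occ [] x f = tt
nth-Occ (a ∷ w) x f = trans (cong p (sym (+-identityʳ x))) (f 0 (s≤s z≤n)) ,
  nth-Occ w (suc x) (λ k k< → trans (cong p (sym (+-suc x k))) (f (suc k) (s≤s k<)))

hIter-Occ : ∀ m → Occ (hIter m) 0
hIter-Occ m = nth-Occ (hIter m) 0 (nth-hIter m)

-- Block decomposition of p and its local constraints

-- The position in p at which the block h(p[i]) starts.
φ : ℕ → ℕ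
φ zero = 0
φ (suc i) = φ i + length (hL (p i))

φ-+ : ∀ w {x} → Occ w x → φ (x + length w) ≡ φ x + length (h w)
φ-+ [] {x} _ = trans (cong φ (+-identityʳ x)) (sym (+-identityʳ (φ x)))
φ-+ (a ∷ w) {x} (refl , o) = begin
  φ (x + suc (length w))                       ≡⟨ cong φ (+-suc x (length w)) ⟩
  φ (suc x + length w)                         ≡⟨ φ-+ w o ⟩
  φ x + length (hL (p x)) + length (h w)       ≡⟨ +-assoc (φ x) _ _ ⟩
  φ x + (length (hL (p x)) + length (h w))     ≡⟨ cong (φ x +_) (sym (length-++ (hL (p x)))) ⟩
  φ x + length (hL (p x) ++ h w)               ∎
  where open ≡-Reasoning

split : ∀ (w : Word) i → i < length w → ∃₂ λ u v → w ≡ u ++ nth l0 w i ∷ v × length u ≡ i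
split (a ∷ w) zero _ = [] , w , refl , refl
split (a ∷ w) (suc i) (s≤s i<) with split w i i<
... | u , v , e , l = a ∷ u , v , cong (a ∷_) e , cong suc l

-- Write h^(i+1)(0) = u p[i] v with |u| = i. Then h(u) h(p[i]) h(v) is again a prefix of p, and φ(i)
-- = |h(u)|.
block : ∀ i → Occ (hL (p i)) (φ i)
block i with split (hIter (suc i)) i (<-trans (n<1+n i) (hIter-length (suc i)))
... | u , v , e , refl = subst (Occ (hL (p i))) (sym φi) (Occ-++ˡ (hL (p i)) (Occ-++ʳ (h u) occ))
  where
  φi : φ i ≡ length (h u)
  φi = φ-+ u (Occ-++ˡ u (subst (λ w → Occ w 0) e (hIter-Occ (suc i))))
  occ : Occ (h u ++ h (p i ∷ v)) 0
  occ = subst (λ w → Occ w 0) (trans (cong h e) (h-++ u (p i ∷ v))) (hIter-Occ (suc (suc i)))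

Occ-h : ∀ w {x} → Occ w x → Occ (h w) (φ x)
Occ-h [] _ = tt
Occ-h (a ∷ w) {x} (refl , o) = Occ-++ (hL (p x)) (block x) (Occ-h w o)

-- A position of p is the first letter of a block h(p i), or the second one (which is then 1).
data Loc : ℕ → Set where
  first  : ∀ i → Loc (φ i)
  second : ∀ i → p i ≢ l2 → φ (suc i) ≡ suc (suc (φ i)) → p (suc (φ i)) ≡ l1 → Loc (suc (φ i))

≢-via : ∀ {x y z : Letter} → x ≡ y → y ≢ z → x ≢ z
≢-via refl ne = ne

loc : ∀ t → Loc t
loc zero = first 0
loc (suc t) with loc t
... | second i _ e _ = subst Loc e (first (suc i))
... | first i with p i in e | block i | first (suc i)
... | l0 | _ , e₁ , _ | f = second i (≢-via e λ ()) (trans (cong (λ a → φ i + length (hL a)) e) (+-comm (φ i) 2)) e₁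
... | l1 | _ , e₁ , _ | f = second i (≢-via e λ ()) (trans (cong (λ a → φ i + length (hL a)) e) (+-comm (φ i) 2)) e₁
-- The block h(2) = 0 has one letter, so the next position already opens the block of `suc i`.
... | l2 | _ | f = subst Loc (+-comm (φ i) 1) f

block0 : ∀ i → p i ≡ l0 → φ (suc i) ≡ suc (suc (φ i)) × p (φ i) ≡ l0 × p (suc (φ i)) ≡ l1
block0 i e with p i | block i
block0 i refl | _ | e₀ , e₁ , _ = +-comm (φ i) 2 , e₀ , e₁

block1 : ∀ i → p i ≡ l1 → φ (suc i) ≡ suc (suc (φ i)) × p (φ i) ≡ l2 × p (suc (φ i)) ≡ l1
block1 i e with p i | block i
block1 i refl | _ | e₀ , e₁ , _ = +-comm (φ i) 2 , e₀ , e₁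

block2 : ∀ i → p i ≡ l2 → φ (suc i) ≡ suc (φ i) × p (φ i) ≡ l0
block2 i e with p i | block i
block2 i refl | _ | e₀ , _ = +-comm (φ i) 1 , e₀

letter : ∀ (a : Letter) → a ≡ l0 ⊎ a ≡ l1 ⊎ a ≡ l2
letter l0 = inj₁ refl
letter l1 = inj₂ (inj₁ refl)
letter l2 = inj₂ (inj₂ refl)

-- No image of a letter begins with 1, so the letter 1 marks exactly the second positions of blocks.
-- Desubstitution rests on this.
first≢1 : ∀ i → p (φ i) ≢ l1
first≢1 i with letter (p i)
... | inj₁ e = ≢-via (proj₁ (proj₂ (block0 i e))) λ ()
... | inj₂ (inj₁ e) = ≢-via (proj₁ (proj₂ (block1 i e))) λ ()
... | inj₂ (inj₂ e) = ≢-via (proj₂ (block2 i e)) λ ()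

first-≢1 : ∀ t → p t ≢ l1 → ∃ λ i → t ≡ φ i
first-≢1 t ne with loc t
... | first i = i , refl
... | second i _ _ e = ⊥-elim (ne e)

second-≡1 : ∀ t → p t ≡ l1 → ∃ λ i → t ≡ suc (φ i) × suc t ≡ φ (suc i) × p i ≢ l2
second-≡1 t e with loc t
... | first i = ⊥-elim (first≢1 i e)
... | second i ne s _ = i , refl , sym s , ne

after2 : ∀ t → p t ≡ l2 → p (suc t) ≡ l1
after2 t e with first-≢1 t (≢-via e λ ())
... | i , refl with letter (p i)
... | inj₁ q = ⊥-elim (≢-via (proj₁ (proj₂ (block0 i q))) (λ ()) e)
... | inj₂ (inj₁ q) = proj₂ (proj₂ (block1 i q))
... | inj₂ (inj₂ q) = ⊥-elim (≢-via (proj₂ (block2 i q)) (λ ()) e)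

-- A 2 is followed by 1, so h(2) is followed by h(1) = 21: a 2 comes after the 0 of h(2), which
-- tells it from the 0 of h(0) = 01.
after-block2 : ∀ i → p i ≡ l2 → p (suc (φ i)) ≡ l2
after-block2 i e = trans (cong p (sym (proj₁ (block2 i e)))) (proj₁ (proj₂ (block1 (suc i) (after2 i e))))

after0 : ∀ t → p t ≡ l0 → p (suc t) ≢ l0
after0 t e with first-≢1 t (≢-via e λ ())
... | i , refl with letter (p i)
... | inj₁ q = ≢-via (proj₂ (proj₂ (block0 i q))) λ ()
... | inj₂ (inj₁ q) = ⊥-elim (≢-via (proj₁ (proj₂ (block1 i q))) (λ ()) e)
... | inj₂ (inj₂ q) = ≢-via (after-block2 i q) λ ()

after1 : ∀ t → p t ≡ l1 → p (suc t) ≢ l1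
after1 t e with second-≡1 t e
... | i , _ , s , _ = λ q → first≢1 (suc i) (trans (cong p (sym s)) q)

-- Lengths and positions of the blocks of h^k

-- `ℓ k a` is |h^k(a)|, and `Λ k w` below is |h^k(w)|.
ℓ : ℕ → Letter → ℕ
ℓ zero _ = 1
ℓ (suc k) l0 = ℓ k l0 + ℓ k l1
ℓ (suc k) l1 = ℓ k l2 + ℓ k l1
ℓ (suc k) l2 = ℓ k l0

Λ : ℕ → Word → ℕ
Λ k [] = 0
Λ k (a ∷ w) = ℓ k a + Λ k w

Λ-zero : ∀ w → Λ 0 w ≡ length w
Λ-zero [] = refl
Λ-zero (a ∷ w) = cong suc (Λ-zero w)

Λ-suc : ∀ k w → Λ (suc k) w ≡ Λ k (h w)
Λ-suc k [] = refl
Λ-suc k (l0 ∷ w) = trans (+-assoc (ℓ k l0) _ _) (cong (λ n → ℓ k l0 + (ℓ k l1 + n)) (Λ-suc k w))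
Λ-suc k (l1 ∷ w) = trans (+-assoc (ℓ k l2) _ _) (cong (λ n → ℓ k l2 + (ℓ k l1 + n)) (Λ-suc k w))
Λ-suc k (l2 ∷ w) = cong (ℓ k l0 +_) (Λ-suc k w)

Λ-++ : ∀ k u v → Λ k (u ++ v) ≡ Λ k u + Λ k v
Λ-++ k [] v = refl
Λ-++ k (a ∷ u) v = trans (cong (ℓ k a +_) (Λ-++ k u v)) (sym (+-assoc (ℓ k a) _ _))

-- The position in p at which the block h^k(p[t]) starts.
φ^ : ℕ → ℕ → ℕ
φ^ zero t = t
φ^ (suc k) t = φ^ k (φ t)

φ^-+ : ∀ k w {x} → Occ w x → φ^ k (x + length w) ≡ φ^ k x + Λ k w
φ^-+ zero w {x} _ = cong (x +_) (sym (Λ-zero w))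
φ^-+ (suc k) w {x} o = begin
  φ^ k (φ (x + length w))      ≡⟨ cong (φ^ k) (φ-+ w o) ⟩
  φ^ k (φ x + length (h w))    ≡⟨ φ^-+ k (h w) (Occ-h w o) ⟩
  φ^ k (φ x) + Λ k (h w)       ≡⟨ cong (φ^ k (φ x) +_) (sym (Λ-suc k w)) ⟩
  φ^ k (φ x) + Λ (suc k) w     ∎
  where open ≡-Reasoning

φ^-suc : ∀ k t → φ^ k (suc t) ≡ φ^ k t + ℓ k (p t)
φ^-suc k t = trans (cong (φ^ k) (+-comm 1 t))
  (trans (φ^-+ k (p t ∷ []) (refl , tt)) (cong (φ^ k t +_) (+-identityʳ _)))

ℓ-pos : ∀ k a → 1 ≤ ℓ k a
ℓ-pos zero _ = s≤s z≤n
ℓ-pos (suc k) l0 = ≤-trans (ℓ-pos k l0) (m≤m+n _ _)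
ℓ-pos (suc k) l1 = ≤-trans (ℓ-pos k l2) (m≤m+n _ _)
ℓ-pos (suc k) l2 = ℓ-pos k l0

Λ-pos : ∀ k w → 1 ≤ length w → 1 ≤ Λ k w
Λ-pos k (a ∷ w) _ = ≤-trans (ℓ-pos k a) (m≤m+n _ _)

φ^-zero : ∀ k → φ^ k 0 ≡ 0
φ^-zero zero = refl
φ^-zero (suc k) = φ^-zero k

locate^ : ∀ k i → ∃ λ t → φ^ k t ≤ i × i < φ^ k (suc t)
locate^ k zero = 0 , ≤-reflexive (φ^-zero k) ,
  ≤-trans (ℓ-pos k (p 0)) (≤-trans (m≤n+m _ (φ^ k 0)) (≤-reflexive (sym (φ^-suc k 0))))
locate^ k (suc i) with locate^ k i
... | t , le , lt with suc i <? φ^ k (suc t)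
... | yes lt′ = t , m≤n⇒m≤1+n le , lt′
... | no ≮ = suc t , ≮⇒≥ ≮ , ≤-<-trans lt (subst (φ^ k (suc t) <_) (sym (φ^-suc k (suc t)))
        (m<m+n _ (ℓ-pos k (p (suc t)))))

φ-<-mono : ∀ {s t} → s < t → φ s < φ t
φ-<-mono {s} {suc t} (s≤s s≤t) with m≤n⇒m<n∨m≡n s≤t
... | inj₁ s<t = <-trans (φ-<-mono s<t) (φ-< t)
  where φ-< : ∀ t → φ t < φ (suc t)
        φ-< t = subst (φ t <_) (sym (φ^-suc 1 t)) (m<m+n _ (ℓ-pos 1 (p t)))
... | inj₂ refl = subst (φ s <_) (sym (φ^-suc 1 s)) (m<m+n _ (ℓ-pos 1 (p s)))

φ-<-cancel : ∀ {s t} → φ s < φ t → s < t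
φ-<-cancel {s} {t} lt with s <? t
... | yes q = q
... | no ≮ with m≤n⇒m<n∨m≡n (≮⇒≥ ≮)
... | inj₁ t<s = ⊥-elim (<-asym lt (φ-<-mono t<s))
... | inj₂ refl = ⊥-elim (<-irrefl refl lt)

-- Images of words extended by forced letters

-- L02 (L01) says that the left neighbours of an occurrence are constrained to {0,2} ({0,1}), and similarly on the right;
-- L∅ and R∅ impose nothing. LC and RC express this by excluding the third letter.
data Left : Set where
  L∅ L02 L01 : Left

data Right : Set where
  R∅ R02 R12 : Right

LC : Left → ℕ → Set
LC L∅ _ = ⊤
LC _ zero = ⊥
LC L02 (suc x) = p x ≢ l1
LC L01 (suc x) = p x ≢ l2

RC : Right → ℕ → Set
RC R∅ _ = ⊤
RC R02 e = p e ≢ l1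
RC R12 e = p e ≢ l0

-- h maps both 0 and 1 to words ending in 1, and h(0), h(2)h(1) both start with 0: these letters are forced.
pre : Left → Word
pre L01 = l1 ∷ []
pre _ = []

post : Right → Word
post R02 = l0 ∷ []
post _ = []

-- h(0) and h(2) end in 1 and 0, which gives {0,1}. Before their common last letter 1, h(0) and h(1)
-- have 0 and 2, which gives {0,2}.
nextL : Left → Left
nextL L∅ = L∅
nextL L02 = L01
nextL L01 = L02

-- After the common first letter 0, h(0) and h(2)h(1) continue with 1 and 2; h(1) and h(2) begin
-- with 2 and 0.
nextR : Right → Right
nextR R∅ = R∅
nextR R02 = R12
nextR R12 = R02

stepL : ∀ l x → LC l x → ∃ λ x′ → x′ + length (pre l) ≡ φ x × Occ (pre l) x′ × LC (nextL l) x′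
stepL L∅ x _ = φ x , +-identityʳ (φ x) , tt , tt
stepL L02 (suc x) ne with letter (p x)
... | inj₁ e = let s , _ , e₁ = block0 x e in
  suc (suc (φ x)) , trans (+-identityʳ _) (sym s) , tt , ≢-via e₁ λ ()
... | inj₂ (inj₁ e) = ⊥-elim (ne e)
... | inj₂ (inj₂ e) = let s , e₀ = block2 x e in
  suc (φ x) , trans (+-identityʳ _) (sym s) , tt , ≢-via e₀ λ ()
stepL L01 (suc x) ne with letter (p x)
... | inj₁ e = let s , e₀ , e₁ = block0 x e in
  suc (φ x) , trans (+-comm _ 1) (sym s) , (e₁ , tt) , ≢-via e₀ λ ()
... | inj₂ (inj₁ e) = let s , e₀ , e₁ = block1 x e in
  suc (φ x) , trans (+-comm _ 1) (sym s) , (e₁ , tt) , ≢-via e₀ λ ()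
... | inj₂ (inj₂ e) = ⊥-elim (ne e)

stepR : ∀ r e → RC r e → Occ (post r) (φ e) × RC (nextR r) (φ e + length (post r))
stepR R∅ e _ = tt , tt
stepR R02 e ne rewrite +-comm (φ e) 1 with letter (p e)
... | inj₁ q = let _ , e₀ , e₁ = block0 e q in (e₀ , tt) , ≢-via e₁ λ ()
... | inj₂ (inj₁ q) = ⊥-elim (ne q)
... | inj₂ (inj₂ q) = (proj₂ (block2 e q) , tt) , ≢-via (after-block2 e q) λ ()
stepR R12 e _ = tt , λ q → first≢1 e (trans (cong p (sym (+-identityʳ (φ e)))) q)

image : Left → Word → Right → Word
image l w r = pre l ++ h w ++ post r

length-image : ∀ l w r → length (image l w r) ≡ length (pre l) + (length (h w) + length (post r))
length-image l w r = trans (length-++ (pre l)) (cong (length (pre l) +_) (length-++ (h w)))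

step : ∀ l w r x → LC l x → Occ w x → RC r (x + length w) →
  ∃ λ x′ → x′ + length (pre l) ≡ φ x × LC (nextL l) x′ × Occ (image l w r) x′ ×
           RC (nextR r) (x′ + length (image l w r))
step l w r x lc o rc with stepL l x lc | stepR r (x + length w) rc
... | x′ , ex , op , lc′ | or , rc′ =
  x′ , ex , lc′ ,
  Occ-++ (pre l) op (subst (Occ (h w ++ post r)) (sym ex)
    (Occ-++ (h w) (Occ-h w o) (subst (Occ (post r)) (φ-+ w o) or))) ,
  subst (RC (nextR r)) end rc′
  where
  end : φ (x + length w) + length (post r) ≡ x′ + length (image l w r)
  end = begin
    φ (x + length w) + length (post r)                                 ≡⟨ cong (_+ length (post r)) (φ-+ w o) ⟩
    φ x + length (h w) + length (post r)                               ≡⟨ +-assoc (φ x) _ _ ⟩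
    φ x + (length (h w) + length (post r))
      ≡⟨ cong (_+ (length (h w) + length (post r))) (sym ex) ⟩
    x′ + length (pre l) + (length (h w) + length (post r))             ≡⟨ +-assoc x′ _ _ ⟩
    x′ + (length (pre l) + (length (h w) + length (post r)))           ≡⟨ cong (x′ +_) (sym (length-image l w r)) ⟩
    x′ + length (image l w r)                                          ∎
    where open ≡-Reasoning

-- The number of letters that k applications of h force on the left (right).
el : Left → ℕ → ℕ
el l zero = 0
el l (suc k) = el (nextL l) k + Λ k (pre l)

er : Right → ℕ → ℕ
er r zero = 0
er r (suc k) = Λ k (post r) + er (nextR r) k

image^ : ℕ → Left → Word → Right → Word
image^ zero l w r = w
image^ (suc k) l w r = image^ k (nextL l) (image l w r) (nextR r)

length-image^ : ∀ k l w r → length (image^ k l w r) ≡ el l k + Λ k w + er r k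
length-image^ zero l w r = trans (sym (Λ-zero w)) (sym (+-identityʳ _))
length-image^ (suc k) l w r = begin
  length (image^ k (nextL l) (image l w r) (nextR r))                           ≡⟨ length-image^ k _ _ _ ⟩
  el (nextL l) k + Λ k (image l w r) + er (nextR r) k
    ≡⟨ cong (λ n → el (nextL l) k + n + er (nextR r) k) (trans (Λ-++ k (pre l) _) (cong (Λ k (pre l) +_) (Λ-++ k (h w) (post r)))) ⟩
  el (nextL l) k + (Λ k (pre l) + (Λ k (h w) + Λ k (post r))) + er (nextR r) k
    ≡⟨ regroup (el (nextL l) k) (Λ k (pre l)) (Λ k (h w)) (Λ k (post r)) _ ⟩
  el (nextL l) k + Λ k (pre l) + Λ k (h w) + (Λ k (post r) + er (nextR r) k)
    ≡⟨ cong (λ n → el (nextL l) k + Λ k (pre l) + n + (Λ k (post r) + er (nextR r) k)) (sym (Λ-suc k w)) ⟩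
  el l (suc k) + Λ (suc k) w + er r (suc k)                                     ∎
  where
  open ≡-Reasoning
  regroup : ∀ a b c d e → a + (b + (c + d)) + e ≡ a + b + c + (d + e)
  regroup = solve-∀

lift : ∀ k l w r x → LC l x → Occ w x → RC r (x + length w) →
  ∃ λ x′ → x′ + el l k ≡ φ^ k x × Occ (image^ k l w r) x′
lift zero l w r x lc o rc = x , +-identityʳ x , o
lift (suc k) l w r x lc o rc with step l w r x lc o rc
... | x₁ , e₁ , lc₁ , o₁ , rc₁ with lift k (nextL l) (image l w r) (nextR r) x₁ lc₁ o₁ rc₁
... | x₂ , e₂ , o₂ = x₂ , start , o₂
  where
  open ≡-Reasoning
  start : x₂ + (el (nextL l) k + Λ k (pre l)) ≡ φ^ k (φ x)
  start = begin
    x₂ + (el (nextL l) k + Λ k (pre l))   ≡⟨ sym (+-assoc x₂ _ _) ⟩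
    x₂ + el (nextL l) k + Λ k (pre l)     ≡⟨ cong (_+ Λ k (pre l)) e₂ ⟩
    -- The letters forced at the first step occur at `x₁`; the other k steps turn them into
    -- `Λ k (pre l)` letters.
    φ^ k x₁ + Λ k (pre l)                 ≡⟨ sym (φ^-+ k (pre l) (Occ-++ˡ (pre l) o₁)) ⟩
    φ^ k (x₁ + length (pre l))            ≡⟨ cong (φ^ k) e₁ ⟩
    φ^ k (φ x)                            ∎

-- Parikh vectors

# : Letter → Word → ℕ
# a [] = 0
# l0 (l0 ∷ w) = suc (# l0 w)
# l1 (l1 ∷ w) = suc (# l1 w)
# l2 (l2 ∷ w) = suc (# l2 w)
# a (_ ∷ w) = # a w

Λ-# : ∀ k w → Λ k w ≡ # l0 w * ℓ k l0 + # l1 w * ℓ k l1 + # l2 w * ℓ k l2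
Λ-# k [] = refl
Λ-# k (l0 ∷ w) = trans (cong (ℓ k l0 +_) (Λ-# k w)) (shift (ℓ k l0) (# l0 w * ℓ k l0) _ _)
  where shift : ∀ a b c d → a + (b + c + d) ≡ a + b + c + d
        shift = solve-∀
Λ-# k (l1 ∷ w) = trans (cong (ℓ k l1 +_) (Λ-# k w)) (shift (ℓ k l1) (# l0 w * ℓ k l0) _ _)
  where shift : ∀ a b c d → a + (b + c + d) ≡ b + (a + c) + d
        shift = solve-∀
Λ-# k (l2 ∷ w) = trans (cong (ℓ k l2 +_) (Λ-# k w)) (shift (ℓ k l2) (# l0 w * ℓ k l0) _ _)
  where shift : ∀ a b c d → a + (b + c + d) ≡ b + c + (a + d)
        shift = solve-∀

-- By `Λ-mono`, one comparison of Parikh vectors bounds the lengths |h^k(u)| for all k at once.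
_≼_ : Word → Word → Set
u ≼ v = # l0 u ≤ # l0 v × # l1 u ≤ # l1 v × # l2 u ≤ # l2 v

_≼?_ : ∀ u v → Dec (u ≼ v)
u ≼? v = # l0 u ≤? # l0 v ×-dec # l1 u ≤? # l1 v ×-dec # l2 u ≤? # l2 v

Λ-mono : ∀ k u v → u ≼ v → Λ k u ≤ Λ k v
Λ-mono k u v (c₀ , c₁ , c₂) rewrite Λ-# k u | Λ-# k v =
  +-mono-≤ (+-mono-≤ (*-monoˡ-≤ (ℓ k l0) c₀) (*-monoˡ-≤ (ℓ k l1) c₁)) (*-monoˡ-≤ (ℓ k l2) c₂)

-- Factors of length 22 and return words

-- The 22-letter windows of a prefix of p; being closed under h, they are all the factors of p of that length.
opaque
  windows : List Word
  windows = deduplicate (≡-dec Fin._≟_) (map (λ i → take 22 (drop i (hIter 9))) (upTo 150))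

  windows-closed : All (λ w → take 22 (h w) ∈ windows × take 22 (drop 1 (h w)) ∈ windows) windows
  windows-closed = from-yes (all? (λ w → (take 22 (h w) ∈? windows) ×-dec (take 22 (drop 1 (h w)) ∈? windows)) windows)

  windows-length : All (λ w → length w ≡ 22) windows
  windows-length = from-yes (all? (λ w → length w ≟ 22) windows)

  window₀ : take 22 (hIter 9) ∈ windows
  window₀ = from-yes (take 22 (hIter 9) ∈? windows)

  window₁ : take 22 (drop 1 (hIter 9)) ∈ windows
  window₁ = from-yes (take 22 (drop 1 (hIter 9)) ∈? windows)

Occ-take : ∀ n w {x} → Occ w x → Occ (take n w) x
Occ-take n w {x} o = Occ-++ˡ (take n w) (subst (λ v → Occ v x) (sym (take++drop≡id n w)) o)

Occ-drop : ∀ n w {x} → Occ w x → Occ (drop n w) (x + length (take n w))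
Occ-drop n w {x} o = Occ-++ʳ (take n w) (subst (λ v → Occ v x) (sym (take++drop≡id n w)) o)

Occ-tail : ∀ w {x} → Occ w x → Occ (drop 1 w) (suc x)
Occ-tail [] _ = tt
Occ-tail (a ∷ w) (_ , o) = o

suc<φ-suc : ∀ i → suc i < φ (suc i)
suc<φ-suc zero = s≤s (s≤s z≤n)
suc<φ-suc (suc i) = <-≤-trans (s≤s (suc<φ-suc i)) (φ-<-mono (n<1+n (suc i)))

-- Strong induction: a position in the block of i inherits its window from the image of the window
-- at i, and i is smaller than the position when i ≥ 1.
window : ∀ t → ∃ λ w → w ∈ windows × Occ w t
window = <-rec _ go
  where
  inWindow : ∀ {t} i → (∃ λ w → w ∈ windows × Occ w i) → t ≡ φ i ⊎ t ≡ suc (φ i) →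
    ∃ λ w → w ∈ windows × Occ w t
  inWindow i (w , m , o) (inj₁ refl) = take 22 (h w) , proj₁ (All-lookup windows-closed m) , Occ-take 22 (h w) (Occ-h w o)
  inWindow i (w , m , o) (inj₂ refl) = take 22 (drop 1 (h w)) , proj₂ (All-lookup windows-closed m) ,
    Occ-take 22 (drop 1 (h w)) (Occ-tail (h w) (Occ-h w o))
  start : ∀ m → Occ (take 22 (hIter m)) 0
  start m = Occ-take 22 (hIter m) (hIter-Occ m)
  start₁ : ∀ m → Occ (take 22 (drop 1 (hIter m))) 1
  start₁ m = Occ-take 22 (drop 1 (hIter m)) (Occ-tail (hIter m) (hIter-Occ m))
  go : ∀ t → (∀ {i} → i < t → ∃ λ w → w ∈ windows × Occ w i) → ∃ λ w → w ∈ windows × Occ w t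
  go t rec with loc t
  -- The block of position 0 starts at 0 itself, so its two positions are base cases.
  ... | first zero = take 22 (hIter 9) , window₀ , start 9
  ... | second zero _ _ _ = take 22 (drop 1 (hIter 9)) , window₁ , start₁ 9
  ... | first (suc i) = inWindow (suc i) (rec (suc<φ-suc i)) (inj₁ refl)
  ... | second (suc i) _ _ _ = inWindow (suc i) (rec (m<n⇒m<1+n (suc<φ-suc i))) (inj₂ refl)

ReturnAt : Word → Word → Word → ℕ → Set
ReturnAt v w z s = 1 ≤ length (take (suc s) z) × take (suc s) z ≼ v × w ≡ take (length w) (drop (suc s) z)

returnAt? : ∀ v w z s → Dec (ReturnAt v w z s)
returnAt? v w z s = 1 ≤? _ ×-dec take (suc s) z ≼? v ×-dec ≡-dec Fin._≟_ w _

-- `u` leads to some later occurrence of `w`, not necessarily the next one; `v` enters only through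
-- its Parikh vector.
Return : Word → Word → ℕ → Set
Return v w x = Occ w x × ∃ λ u → 1 ≤ length u × u ≼ v × Occ u x × Occ w (x + length u)

-- A word dominated by any of the bounds in use has at most 16 letters, and the words `w` have at
-- most five, so both occurrences fit in a window of 22 letters.
Returns : Word → Word → Set
Returns v w = length w ≤ 22 × All (λ z → w ≡ take (length w) z → Any (ReturnAt v w z) (upTo 16)) windows

returns? : ∀ v w → Dec (Returns v w)
returns? v w = length w ≤? 22 ×-dec all? (λ z → ≡-dec Fin._≟_ w _ →-dec any? (returnAt? v w z) (upTo 16)) windows

Occ-unique : ∀ u v x → length u ≡ length v → Occ u x → Occ v x → u ≡ v
Occ-unique [] [] x _ _ _ = refl
Occ-unique (a ∷ u) (b ∷ v) x l (e , o) (e′ , o′) =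
  cong₂ _∷_ (trans (sym e) e′) (Occ-unique u v (suc x) (suc-injective l) o o′)

return : ∀ v w → Returns v w → ∀ {x} → Occ w x → Return v w x
return v w (w≤22 , rs) {x} o with window x
... | z , m , oz with All-lookup rs m
       (Occ-unique w _ x (sym (trans (length-take (length w) z)
         (m≤n⇒m⊓n≡m (subst (length w ≤_) (sym (All-lookup windows-length m)) w≤22)))) o (Occ-take (length w) z oz))
... | a with satisfied a
... | s , pos , dom , e = o , take (suc s) z , pos , dom , Occ-take (suc s) z oz ,
  subst (λ w → Occ w (x + length (take (suc s) z))) (sym e) (Occ-take (length w) (drop (suc s) z) (Occ-drop (suc s) z oz))

-- The longest return words, of lengths R(2) = 12 and R(3) = 16, have the Parikh vectors of h⁴(0) and h⁴(0)h²(0).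
V₁ V₂ : Word
V₁ = hIter 4
V₂ = hIter 4 ++ hIter 2

-- The words whose extended images form the cover in `recurrent₁`; `words₂` plays this part for
-- `recurrent₂`.
words₁ : List Word
words₁ =
  (l0 ∷ l1 ∷ []) ∷
  (l2 ∷ l1 ∷ []) ∷
  (l1 ∷ l0 ∷ l1 ∷ []) ∷
  (l1 ∷ l0 ∷ l2 ∷ l1 ∷ []) ∷
  (l0 ∷ l2 ∷ l1 ∷ l0 ∷ []) ∷
  (l1 ∷ l2 ∷ l1 ∷ l0 ∷ []) ∷ []

words₂ : List Word
words₂ =
  (l0 ∷ l1 ∷ l0 ∷ []) ∷
  (l2 ∷ l1 ∷ l0 ∷ []) ∷
  (l1 ∷ l0 ∷ l1 ∷ l0 ∷ []) ∷
  (l1 ∷ l0 ∷ l1 ∷ l2 ∷ []) ∷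
  (l1 ∷ l0 ∷ l2 ∷ l1 ∷ []) ∷
  (l1 ∷ l0 ∷ l1 ∷ l0 ∷ l2 ∷ []) ∷
  (l1 ∷ l0 ∷ l1 ∷ l2 ∷ l1 ∷ []) ∷
  (l1 ∷ l0 ∷ l2 ∷ l1 ∷ l0 ∷ []) ∷
  (l0 ∷ l1 ∷ l2 ∷ l1 ∷ l0 ∷ []) ∷
  (l0 ∷ l2 ∷ l1 ∷ l0 ∷ []) ∷
  (l1 ∷ l2 ∷ l1 ∷ l0 ∷ []) ∷ []

-- The lists `cases` in both covers follow this order.
fives : List Word
fives =
  (l0 ∷ l1 ∷ l0 ∷ l2 ∷ l1 ∷ []) ∷
  (l0 ∷ l1 ∷ l2 ∷ l1 ∷ l0 ∷ []) ∷
  (l0 ∷ l2 ∷ l1 ∷ l0 ∷ l1 ∷ []) ∷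
  (l1 ∷ l0 ∷ l1 ∷ l0 ∷ l2 ∷ []) ∷
  (l1 ∷ l0 ∷ l1 ∷ l2 ∷ l1 ∷ []) ∷
  (l1 ∷ l0 ∷ l2 ∷ l1 ∷ l0 ∷ []) ∷
  (l1 ∷ l2 ∷ l1 ∷ l0 ∷ l1 ∷ []) ∷
  (l1 ∷ l2 ∷ l1 ∷ l0 ∷ l2 ∷ []) ∷
  (l2 ∷ l1 ∷ l0 ∷ l1 ∷ l0 ∷ []) ∷
  (l2 ∷ l1 ∷ l0 ∷ l1 ∷ l2 ∷ []) ∷
  (l2 ∷ l1 ∷ l0 ∷ l2 ∷ l1 ∷ []) ∷ []

opaque
  unfolding windows

  returns₁ : All (Returns V₁) words₁
  returns₁ = from-yes (all? (returns? V₁) words₁)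

  returns₂ : All (Returns V₂) words₂
  returns₂ = from-yes (all? (returns? V₂) words₂)

  windows-fives : All (λ z → take 5 z ∈ fives) windows
  windows-fives = from-yes (all? (λ z → take 5 z ∈? fives) windows)

return₁ : ∀ w {_ : True (w ∈? words₁)} {x} → Occ w x → Return V₁ w x
return₁ w {i} = return V₁ w (All-lookup returns₁ (toWitness i))

return₂ : ∀ w {_ : True (w ∈? words₂)} {x} → Occ w x → Return V₂ w x
return₂ w {i} = return V₂ w (All-lookup returns₂ (toWitness i))

five : ∀ t → ∃ λ f → f ∈ fives × Occ f t
five t with window t
... | z , m , o = take 5 z , All-lookup windows-fives m , Occ-take 5 z o

-- Recurrence of windows inside an interval

-- Conditions on the word alone that force the neighbour constraints: neither 11 nor 00 occurs in p.
starts : Left → Word → Set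
starts L∅ _ = ⊤
starts L02 (a ∷ _) = a ≡ l1
starts _ _ = ⊥

ends : Right → Word → Set
ends R∅ _ = ⊤
ends r [] = ⊥
ends R02 (a ∷ []) = a ≡ l1
ends R12 (a ∷ []) = a ≡ l0
ends r (_ ∷ w@(_ ∷ _)) = ends r w

starts-LC : ∀ l w x → starts l w → Occ w (suc x) → LC l (suc x)
starts-LC L∅ _ _ _ _ = tt
starts-LC L02 (a ∷ w) x refl (e , _) q = after1 x q e

ends-RC : ∀ r w x → ends r w → Occ w x → RC r (x + length w)
ends-RC R∅ _ _ _ _ = tt
ends-RC R02 (a ∷ []) x refl (e , _) rewrite +-comm x 1 = after1 x e
ends-RC R12 (a ∷ []) x refl (e , _) rewrite +-comm x 1 = after0 x e
ends-RC R02 (_ ∷ w@(_ ∷ _)) x en (_ , o) = subst (RC R02) (sym (+-suc x (length w))) (ends-RC R02 w (suc x) en o)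
ends-RC R12 (_ ∷ w@(_ ∷ _)) x en (_ , o) = subst (RC R12) (sym (+-suc x (length w))) (ends-RC R12 w (suc x) en o)

Recurs : ℕ → ℕ → ℕ → Set
Recurs i n m = ∃ λ j → i < j × j ≤ i + m × (∀ k → k < n → p (j + k) ≡ p (i + k))

-- The extended image of `w` reaches from `el l k` letters before the block of x to `er r k` letters
-- after h^k(w). Its copy lies |h^k(u)| further on, so every window inside it recurs at that
-- distance.
recurs : ∀ k v l w r x i n → (∀ z → x ≤ z → Occ w z → LC l z) → ends r w → Return v w x →
  φ^ k x ≤ i + el l k → i + n ≤ φ^ k x + Λ k w + er r k → Recurs i n (Λ k v)
recurs k v l w r x i n lc en (o , u , pos , dom , ou , ow) x≤i i≤x
  with lift k l w r x (lc x ≤-refl o) o (ends-RC r w x en o)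
     | lift k l w r (x + length u) (lc _ (m≤m+n x _) ow) ow (ends-RC r w _ en ow)
... | a , ea , oa | b , eb , ob = i + Λ k u , m<m+n i (Λ-pos k u pos) , +-monoʳ-≤ i (Λ-mono k u v dom) , match
  where
  a≤i : a ≤ i
  a≤i = +-cancelʳ-≤ (el l k) a i (subst (_≤ i + el l k) (sym ea) x≤i)
  q = i ∸ a
  iq : i ≡ a + q
  iq = sym (m+[n∸m]≡n a≤i)
  b≡ : b ≡ a + Λ k u
  b≡ = +-cancelʳ-≡ (el l k) b (a + Λ k u) (trans eb (trans (φ^-+ k u ou) (trans (cong (_+ Λ k u) (sym ea)) (swap a (el l k) (Λ k u)))))
    where swap : ∀ a b c → a + b + c ≡ a + c + b
          swap = solve-∀
  q≤ : q + n ≤ length (image^ k l w r)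
  q≤ = +-cancelˡ-≤ a _ _ (begin
    a + (q + n)                          ≡⟨ sym (+-assoc a q n) ⟩
    a + q + n                            ≡⟨ cong (_+ n) (sym iq) ⟩
    i + n                                ≤⟨ i≤x ⟩
    φ^ k x + Λ k w + er r k              ≡⟨ cong (λ m → m + Λ k w + er r k) (sym ea) ⟩
    a + el l k + Λ k w + er r k          ≡⟨ assoc a (el l k) (Λ k w) (er r k) ⟩
    a + (el l k + Λ k w + er r k)        ≡⟨ cong (a +_) (sym (length-image^ k l w r)) ⟩
    a + length (image^ k l w r)          ∎)
    where open ≤-Reasoning
          assoc : ∀ a b c d → a + b + c + d ≡ a + (b + c + d)
          assoc = solve-∀
  match : ∀ m → m < n → p (i + Λ k u + m) ≡ p (i + m)
  match m m<n = begin
    p (i + Λ k u + m)      ≡⟨ cong (λ i → p (i + Λ k u + m)) iq ⟩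
    p (a + q + Λ k u + m)  ≡⟨ cong p (shift a q (Λ k u) m) ⟩
    p (a + Λ k u + (q + m)) ≡⟨ cong (λ b → p (b + (q + m))) (sym b≡) ⟩
    p (b + (q + m))        ≡⟨ Occ-match (image^ k l w r) oa ob (q + m) (<-≤-trans (+-monoʳ-< q m<n) q≤) ⟩
    p (a + (q + m))        ≡⟨ cong p (sym (+-assoc a q m)) ⟩
    p (a + q + m)          ≡⟨ cong (λ i → p (i + m)) (sym iq) ⟩
    p (i + m)              ∎
    where open ≡-Reasoning
          shift : ∀ a b c d → a + b + c + d ≡ a + c + (b + d)
          shift = solve-∀

-- The window starts no later than the last letter of the block of t, so N letters to the right of
-- that block are enough.
cover-one : ∀ k v a w r t i N → ends r (a ∷ w) → Return v (a ∷ w) t → φ^ k t ≤ i → i < φ^ k (suc t) →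
  N ≤ Λ k w + er r k → Recurs i (suc N) (Λ k v)
cover-one k v a w r t i N en ret@((e , _) , _) t≤i i<t N≤ =
  recurs k v L∅ (a ∷ w) r t i (suc N) (λ _ _ _ → tt) en ret (m≤n⇒m≤n+o (el L∅ k) t≤i) (begin
    i + suc N                                ≡⟨ +-suc i N ⟩
    suc i + N                                ≤⟨ +-mono-≤ i<t N≤ ⟩
    φ^ k (suc t) + (Λ k w + er r k)          ≡⟨ cong (_+ (Λ k w + er r k)) (φ^-suc k t) ⟩
    φ^ k t + ℓ k (p t) + (Λ k w + er r k)    ≡⟨ cong (λ a → φ^ k t + ℓ k a + (Λ k w + er r k)) e ⟩
    φ^ k t + ℓ k a + (Λ k w + er r k)        ≡⟨ assoc (φ^ k t) (ℓ k a) (Λ k w) (er r k) ⟩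
    φ^ k t + (ℓ k a + Λ k w) + er r k        ∎)
  where open ≤-Reasoning
        assoc : ∀ a b c d → a + b + (c + d) ≡ a + (b + c) + d
        assoc = solve-∀

-- A window that starts in the block of t and reaches beyond the first interval starts inside the second one,
-- because the overlap of the two intervals has length at least N.
cover-two : ∀ k v a u r w t i N → ends r (a ∷ u) → starts L02 w → Return v (a ∷ u) t → Return v w (suc t) →
  φ^ k t ≤ i → i < φ^ k (suc t) → N ≤ Λ k u + er r k + el L02 k → N ≤ Λ k w + er R∅ k → Recurs i (suc N) (Λ k v)
cover-two k v a u r w t i N en st ret@((e , _) , _) ret′ t≤i i<t N≤ N≤′
  with i + suc N ≤? φ^ k t + Λ k (a ∷ u) + er r k
... | yes fits = recurs k v L∅ (a ∷ u) r t i (suc N) (λ _ _ _ → tt) en ret (m≤n⇒m≤n+o (el L∅ k) t≤i) fits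
... | no beyond = recurs k v L02 w R∅ (suc t) i (suc N) lc tt ret′ begins (begin
    i + suc N                           ≡⟨ +-suc i N ⟩
    suc i + N                           ≤⟨ +-mono-≤ i<t N≤′ ⟩
    φ^ k (suc t) + (Λ k w + er R∅ k)    ≡⟨ sym (+-assoc (φ^ k (suc t)) _ _) ⟩
    φ^ k (suc t) + Λ k w + er R∅ k      ∎)
  where
  open ≤-Reasoning
  lc : ∀ z → suc t ≤ z → Occ w z → LC L02 z
  lc (suc z) _ = starts-LC L02 w z st
  assoc : ∀ a b c d e → a + b + (c + d + e) ≡ a + (b + c) + d + e
  assoc = solve-∀
  shift : ∀ a b c → suc a + b + c ≡ a + suc c + b
  shift = solve-∀
  begins : φ^ k (suc t) ≤ i + el L02 k
  begins = +-cancelʳ-≤ N _ _ (s≤s⁻¹ (begin-strict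
    φ^ k (suc t) + N                                        ≡⟨ cong (_+ N) (φ^-suc k t) ⟩
    φ^ k t + ℓ k (p t) + N                                  ≡⟨ cong (λ a → φ^ k t + ℓ k a + N) e ⟩
    φ^ k t + ℓ k a + N                                      ≤⟨ +-monoʳ-≤ (φ^ k t + ℓ k a) N≤ ⟩
    φ^ k t + ℓ k a + (Λ k u + er r k + el L02 k)            ≡⟨ assoc (φ^ k t) (ℓ k a) (Λ k u) (er r k) _ ⟩
    φ^ k t + (ℓ k a + Λ k u) + er r k + el L02 k            <⟨ +-monoˡ-< (el L02 k) (≰⇒> beyond) ⟩
    i + suc N + el L02 k                                    ≡⟨ sym (shift i (el L02 k) N) ⟩
    suc (i + el L02 k + N)                                  ∎))

-- Bounds on the numbers of forced letters

-- The three inequalities feed one another: the first at k + 1 is the third at k.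
ℓ2≤ℓ1 : ∀ k → ℓ k l2 ≤ ℓ k l1
ℓ1≤ℓ0 : ∀ k → ℓ k l1 ≤ ℓ k l0
ℓ0≤ℓ1+ℓ2 : ∀ k → ℓ k l0 ≤ ℓ k l2 + ℓ k l1
ℓ2≤ℓ1 zero = ≤-refl
ℓ2≤ℓ1 (suc k) = ℓ0≤ℓ1+ℓ2 k
ℓ1≤ℓ0 zero = ≤-refl
ℓ1≤ℓ0 (suc k) = +-monoˡ-≤ (ℓ k l1) (≤-trans (ℓ2≤ℓ1 k) (ℓ1≤ℓ0 k))
ℓ0≤ℓ1+ℓ2 zero = s≤s z≤n
ℓ0≤ℓ1+ℓ2 (suc k) = +-monoʳ-≤ (ℓ k l0) (m≤n+m (ℓ k l1) (ℓ k l2))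

ℓ2≤ℓ0 : ∀ k → ℓ k l2 ≤ ℓ k l0
ℓ2≤ℓ0 k = ≤-trans (ℓ2≤ℓ1 k) (ℓ1≤ℓ0 k)

el02≤ℓ2 : ∀ k → el L02 k ≤ ℓ k l2
el01≤ℓ0 : ∀ k → el L01 k ≤ ℓ k l0
el02≤ℓ2 zero = z≤n
el02≤ℓ2 (suc k) = subst (_≤ ℓ k l0) (sym (+-identityʳ _)) (el01≤ℓ0 k)
el01≤ℓ0 zero = z≤n
el01≤ℓ0 (suc k) = +-mono-≤ (≤-trans (el02≤ℓ2 k) (ℓ2≤ℓ0 k)) (≤-reflexive (+-identityʳ (ℓ k l1)))

-- As 2 is followed by 1, the letters forced before {0,2} are a common prefix of h^k(0) and h^k(21),
-- whence two bounds.
er02≤ℓ0 : ∀ k → er R02 k ≤ ℓ k l0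
er02≤ℓ1+ℓ2 : ∀ k → er R02 k ≤ ℓ k l2 + ℓ k l1
er12≤ℓ1 : ∀ k → er R12 k ≤ ℓ k l1
er02≤ℓ0 zero = z≤n
er02≤ℓ0 (suc k) = +-mono-≤ (≤-reflexive (+-identityʳ (ℓ k l0))) (er12≤ℓ1 k)
er02≤ℓ1+ℓ2 zero = z≤n
er02≤ℓ1+ℓ2 (suc k) = +-mono-≤ (≤-reflexive (+-identityʳ (ℓ k l0))) (≤-trans (er12≤ℓ1 k) (m≤n+m _ _))
er12≤ℓ1 zero = z≤n
er12≤ℓ1 (suc k) = er02≤ℓ1+ℓ2 k

-- The lengths of the k-th images of the bispecial words 1 and 10; later shown to be C(k+2) - 1 and
-- (for k ≥ 1) B(k+2) - 2.
N₁ N₂ : ℕ → ℕ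
N₁ k = Λ k (l1 ∷ []) + er R02 k + el L02 k
N₂ k = Λ k (l1 ∷ l0 ∷ []) + er R12 k + el L02 k

-- Replacing the forced letters on each side by the image of a whole letter turns a length estimate
-- into a comparison of Parikh vectors.
extend : ∀ k w {a b x y} → x ≤ ℓ k a → y ≤ ℓ k b → Λ k w + x + y ≤ Λ k (b ∷ a ∷ w)
extend k w {a} {b} {x} {y} x≤ y≤ = begin
  Λ k w + x + y          ≤⟨ +-mono-≤ (+-monoʳ-≤ (Λ k w) x≤) y≤ ⟩
  Λ k w + ℓ k a + ℓ k b  ≡⟨ swap (Λ k w) (ℓ k a) (ℓ k b) ⟩
  Λ k (b ∷ a ∷ w)        ∎
  where open ≤-Reasoning
        swap : ∀ x y z → x + y + z ≡ z + (y + x)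
        swap = solve-∀

extend-left : ∀ k w a r → el L02 k ≤ ℓ k a → Λ k w + er r k + el L02 k ≤ Λ k (a ∷ w) + er r k
extend-left k w a r el≤ = ≤-trans (+-monoʳ-≤ _ el≤) (≤-reflexive (swap (Λ k w) (er r k) (ℓ k a)))
  where swap : ∀ x y z → x + y + z ≡ z + x + y
        swap = solve-∀

-- Covers by intervals: the upper bounds

module Cover (k : ℕ) (v : Word) (N : ℕ) (words : List Word)
  (ret : ∀ w {_ : True (w ∈? words)} {x} → Occ w x → Return v w x) where

  record Covered (f : Word) : Set where
    field cover : ∀ t i → Occ f t → φ^ k t ≤ i → i < φ^ k (suc t) → Recurs i (suc N) (Λ k v)

  open Covered public

  record Bound (u : Word) (r : Right) : Set where
    constructor bound
    field holds : N ≤ Λ k u + er r k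

  weaken : ∀ {u r} w {_ : True (u ≼? w)} → Bound u r → N ≤ Λ k w + er r k
  weaken {u} {r} w {d} (bound N≤) = ≤-trans N≤ (+-monoˡ-≤ (er r k) (Λ-mono k u w (toWitness d)))

  one : ∀ {a f u} n r {_ : True (take (suc n) (a ∷ f) ∈? words)} {_ : True (u ≼? take n f)} →
    ends r (take (suc n) (a ∷ f)) → Bound u r → Covered (a ∷ f)
  cover (one {a} {f} {u} n r {m} {d} en N≤) t i o t≤i i<t =
    cover-one k v a (take n f) r t i N en (ret _ {m} (Occ-take (suc n) (a ∷ f) o)) t≤i i<t (weaken (take n f) {d} N≤)

  -- The first interval comes from the first n + 1 letters of the factor, the second from the m
  -- letters after its first one.
  two : ∀ {a f u} n r m {_ : True (take (suc n) (a ∷ f) ∈? words)} {_ : True (take m f ∈? words)}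
    {_ : True (u ≼? take m f)} → ends r (take (suc n) (a ∷ f)) → starts L02 (take m f) →
    N ≤ Λ k (take n f) + er r k + el L02 k → Bound u R∅ → Covered (a ∷ f)
  cover (two {a} {f} {u} n r m {m₁} {m₂} {d} en st N≤ N≤′) t i o t≤i i<t =
    cover-two k v a (take n f) r (take m f) t i N en st (ret _ {m₁} (Occ-take (suc n) (a ∷ f) o))
      (ret _ {m₂} (Occ-take m f (proj₂ o))) t≤i i<t N≤ (weaken (take m f) {d} N≤′)

recurrent₁ : ∀ k i → Recurs i (suc (N₁ k)) (Λ k V₁)
recurrent₁ k i with locate^ k i
... | t , t≤i , i<t with five t
... | f , m , o = cover (All-lookup cases m) t i o t≤i i<t
  where
  open Cover k V₁ (N₁ k) words₁ return₁
  -- In `N₁ k`, the letters forced on the right fit in |h^k(0)| and those on the left in |h^k(2)|.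
  -- Only the letter counts of 201 matter.
  b201 : Bound (l2 ∷ l0 ∷ l1 ∷ []) R∅
  b201 = bound (m≤n⇒m≤n+o _ (extend k (l1 ∷ []) (er02≤ℓ0 k) (el02≤ℓ2 k)))
  b101 : Bound (l1 ∷ l0 ∷ l1 ∷ []) R∅
  b101 = bound (m≤n⇒m≤n+o _ (extend k (l1 ∷ []) (er02≤ℓ0 k) (≤-trans (el02≤ℓ2 k) (ℓ2≤ℓ1 k))))
  b01 : Bound (l0 ∷ l1 ∷ []) R02
  b01 = bound (extend-left k (l1 ∷ []) l0 R02 (≤-trans (el02≤ℓ2 k) (ℓ2≤ℓ0 k)))

  cases : All Covered fives
  cases =
    -- The first word ends in the 1 with which the second begins: the overlap has length exactly
    -- `N₁ k`.
    two 1 R02 4 refl refl ≤-refl b201 ∷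
    two 1 R02 4 refl refl ≤-refl b201 ∷
    one 3 R∅ tt b201 ∷
    one 2 R02 refl b01 ∷
    one 2 R02 refl b01 ∷
    one 3 R∅ tt b201 ∷
    one 3 R∅ tt b201 ∷
    one 3 R∅ tt b201 ∷
    two 1 R02 3 refl refl ≤-refl b101 ∷
    two 1 R02 3 refl refl ≤-refl b101 ∷
    two 1 R02 4 refl refl ≤-refl b201 ∷ []

recurrent₂ : ∀ k i → Recurs i (suc (N₂ k)) (Λ k V₂)
recurrent₂ k i with locate^ k i
... | t , t≤i , i<t with five t
... | f , m , o = cover (All-lookup cases m) t i o t≤i i<t
  where
  open Cover k V₂ (N₂ k) words₂ return₂
  b2110 : Bound (l2 ∷ l1 ∷ l1 ∷ l0 ∷ []) R∅
  b2110 = bound (m≤n⇒m≤n+o _ (extend k (l1 ∷ l0 ∷ []) (er12≤ℓ1 k) (el02≤ℓ2 k)))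
  b0110 : Bound (l0 ∷ l1 ∷ l1 ∷ l0 ∷ []) R∅
  b0110 = bound (m≤n⇒m≤n+o _ (extend k (l1 ∷ l0 ∷ []) (er12≤ℓ1 k) (≤-trans (el02≤ℓ2 k) (ℓ2≤ℓ0 k))))
  b2010 : Bound (l2 ∷ l0 ∷ l1 ∷ l0 ∷ []) R∅
  b2010 = bound (m≤n⇒m≤n+o _ (extend k (l1 ∷ l0 ∷ []) (≤-trans (er12≤ℓ1 k) (ℓ1≤ℓ0 k)) (el02≤ℓ2 k)))
  b210 : Bound (l2 ∷ l1 ∷ l0 ∷ []) R12
  b210 = bound (extend-left k (l1 ∷ l0 ∷ []) l2 R12 (el02≤ℓ2 k))

  cases : All Covered fives
  cases =
    -- Here the words share 10, and the overlap has length exactly `N₂ k`.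
    two 2 R12 4 refl refl ≤-refl b2110 ∷
    one 4 R∅ tt b2110 ∷
    one 3 R12 refl b210 ∷
    one 4 R∅ tt b2010 ∷
    one 4 R∅ tt b2110 ∷
    one 4 R∅ tt b2010 ∷
    one 3 R12 refl b210 ∷
    one 3 R12 refl b210 ∷
    two 2 R12 4 refl refl ≤-refl b0110 ∷
    two 2 R12 4 refl refl ≤-refl b2110 ∷
    two 2 R12 4 refl refl ≤-refl b2110 ∷ []

-- Desubstitution of consecutive occurrences: the lower bounds

record Consecutive (w : Word) (x y : ℕ) : Set where
  field
    occ₁ : Occ w x
    occ₂ : Occ w y
    ordered : x < y
    between : ∀ z → x < z → z < y → ¬ Occ w z

-- In a word a u b, admissibility makes the image of the bispecial word u determine u, and the neighbours of
-- that image determine a and b. The free sides L∅ and R∅ play no role here.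
admissibleL : Left → Letter → Word → Set
admissibleL L∅ _ _ = ⊥
admissibleL L02 a u = a ≢ l1 × starts L02 u
admissibleL L01 a u = a ≢ l2 × 1 ≤ length u

admissibleR : Right → Letter → Word → Set
admissibleR R∅ _ _ = ⊥
admissibleR R02 b u = b ≢ l1
admissibleR R12 b u = b ≢ l0 × ends R12 u

-- The letter next to the image of u when a (resp. b) is next to u; arbitrary on inadmissible letters.
imageL : Left → Letter → Letter
imageL L01 l0 = l0
imageL L01 _ = l2
imageL _ l2 = l0
imageL _ _ = l1

imageR : Right → Letter → Letter
imageR R02 l0 = l1
imageR R02 _ = l2
imageR _ l1 = l2
imageR _ _ = l0

Occ-head : ∀ u b {x} → b ≢ l1 → Occ (h u ++ b ∷ []) x → p x ≢ l1
Occ-head [] b ne (e , _) = ≢-via e ne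
Occ-head (l0 ∷ u) b ne (e , _) = ≢-via e λ ()
Occ-head (l1 ∷ u) b ne (e , _) = ≢-via e λ ()
Occ-head (l2 ∷ u) b ne (e , _) = ≢-via e λ ()

clash : ∀ {A : Set} {x a b : Letter} → x ≡ a → x ≡ b → a ≢ b → A
clash e e′ ne = ⊥-elim (ne (trans (sym e) e′))

-- Blocks are read from left to right: 2 opens h(1), and 0 opens h(0) or is h(2) according to
-- whether 1 follows. The letter b ≠ 1 settles this for the last block.
decode : ∀ u b y → b ≢ l1 → Occ (h u ++ b ∷ []) (φ y) → Occ u y × p (φ (y + length u)) ≡ b
decode [] b y ne (e , _) = tt , trans (cong (λ y → p (φ y)) (+-identityʳ y)) e
decode (a ∷ u) b y ne o = (proj₁ hd , proj₁ rest) , trans (cong (λ y → p (φ y)) (+-suc y (length u))) (proj₂ rest)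
  where
  split-head : ∀ a → Occ (h (a ∷ u) ++ b ∷ []) (φ y) → p y ≡ a × Occ (h u ++ b ∷ []) (φ (suc y))
  split-head a o with letter (p y)
  split-head l0 (e₀ , e₁ , o) | inj₁ q = q , subst (Occ (h u ++ b ∷ [])) (sym (proj₁ (block0 y q))) o
  split-head l1 (e₀ , o) | inj₁ q = clash e₀ (proj₁ (proj₂ (block0 y q))) λ ()
  split-head l2 (e₀ , o) | inj₁ q = ⊥-elim (Occ-head u b ne o (proj₂ (proj₂ (block0 y q))))
  split-head l0 (e₀ , o) | inj₂ (inj₁ q) = clash e₀ (proj₁ (proj₂ (block1 y q))) λ ()
  split-head l1 (e₀ , e₁ , o) | inj₂ (inj₁ q) = q , subst (Occ (h u ++ b ∷ [])) (sym (proj₁ (block1 y q))) o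
  split-head l2 (e₀ , o) | inj₂ (inj₁ q) = clash e₀ (proj₁ (proj₂ (block1 y q))) λ ()
  split-head l0 (e₀ , e₁ , o) | inj₂ (inj₂ q) = clash e₁ (after-block2 y q) λ ()
  split-head l1 (e₀ , o) | inj₂ (inj₂ q) = clash e₀ (proj₂ (block2 y q)) λ ()
  split-head l2 (e₀ , o) | inj₂ (inj₂ q) = q , subst (Occ (h u ++ b ∷ [])) (sym (proj₁ (block2 y q))) o
  hd = split-head a o
  rest = decode u b (suc y) ne (proj₂ hd)

decodeR : ∀ r b u y → admissibleR r b u → Occ (h u ++ post r ++ imageR r b ∷ []) (φ y) → Occ (u ++ b ∷ []) y
decodeR R02 l1 u y ne o = ⊥-elim (ne refl)
decodeR R02 l0 u y _ o with decode u l0 y (λ ()) (Occ-++ˡ (h u ++ l0 ∷ []) (subst (λ w → Occ w (φ y)) (sym (++-assoc (h u) _ _)) o))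
... | ou , e₀ = Occ-++ u ou (last , tt)
  where
  e₁ : p (suc (φ (y + length u))) ≡ l1
  e₁ = trans (cong (λ x → p (suc x)) (φ-+ u ou)) (proj₁ (proj₂ (Occ-++ʳ (h u) o)))
  last : p (y + length u) ≡ l0
  last with letter (p (y + length u))
  ... | inj₁ q = q
  ... | inj₂ (inj₁ q) = clash e₀ (proj₁ (proj₂ (block1 (y + length u) q))) λ ()
  ... | inj₂ (inj₂ q) = clash e₁ (after-block2 (y + length u) q) λ ()
decodeR R02 l2 u y _ o with decode u l0 y (λ ()) (Occ-++ˡ (h u ++ l0 ∷ []) (subst (λ w → Occ w (φ y)) (sym (++-assoc (h u) _ _)) o))
... | ou , e₀ = Occ-++ u ou (last , tt)
  where
  e₁ : p (suc (φ (y + length u))) ≡ l2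
  e₁ = trans (cong (λ x → p (suc x)) (φ-+ u ou)) (proj₁ (proj₂ (Occ-++ʳ (h u) o)))
  last : p (y + length u) ≡ l2
  last with letter (p (y + length u))
  ... | inj₁ q = clash e₁ (proj₂ (proj₂ (block0 (y + length u) q))) λ ()
  ... | inj₂ (inj₁ q) = clash e₀ (proj₁ (proj₂ (block1 (y + length u) q))) λ ()
  ... | inj₂ (inj₂ q) = q
decodeR R12 l0 u y (ne , _) o = ⊥-elim (ne refl)
decodeR R12 l1 u y (_ , en) o with decode u l2 y (λ ()) o
... | ou , e₀ = Occ-++ u ou (last , tt)
  where
  last : p (y + length u) ≡ l1
  last with letter (p (y + length u))
  ... | inj₁ q = clash e₀ (proj₁ (proj₂ (block0 (y + length u) q))) λ ()
  ... | inj₂ (inj₁ q) = q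
  ... | inj₂ (inj₂ q) = clash e₀ (proj₂ (block2 (y + length u) q)) λ ()
decodeR R12 l2 u y (_ , en) o with decode u l0 y (λ ()) o
... | ou , e₀ = Occ-++ u ou (last , tt)
  where
  last : p (y + length u) ≡ l2
  last with letter (p (y + length u))
  -- `u` ends in 0 and 00 does not occur, so this 0 does not come from h(0).
  ... | inj₁ q = ⊥-elim (ends-RC R12 u y en ou q)
  ... | inj₂ (inj₁ q) = clash e₀ (proj₁ (proj₂ (block1 (y + length u) q))) λ ()
  ... | inj₂ (inj₂ q) = q

encodeR : ∀ r b u y → admissibleR r b u → p y ≡ b → Occ (post r ++ imageR r b ∷ []) (φ y)
encodeR R02 l0 u y _ e = let _ , e₀ , e₁ = block0 y e in e₀ , e₁ , tt
encodeR R02 l1 u y ne e = ⊥-elim (ne refl)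
encodeR R02 l2 u y _ e = proj₂ (block2 y e) , after-block2 y e , tt
encodeR R12 l0 u y (ne , _) e = ⊥-elim (ne refl)
encodeR R12 l1 u y _ e = proj₁ (proj₂ (block1 y e)) , tt
encodeR R12 l2 u y _ e = proj₂ (block2 y e) , tt

encodeL : ∀ l a u x → admissibleL l a u → p x ≡ a →
  ∃ λ x′ → suc x′ + length (pre l) ≡ φ (suc x) × Occ (imageL l a ∷ pre l) x′
encodeL L02 l0 u x _ e = let s , _ , e₁ = block0 x e in suc (φ x) , trans (+-identityʳ _) (sym s) , e₁ , tt
encodeL L02 l1 u x (ne , _) e = ⊥-elim (ne refl)
encodeL L02 l2 u x _ e = let s , e₀ = block2 x e in φ x , trans (+-identityʳ _) (sym s) , e₀ , tt
encodeL L01 l0 u x _ e = let s , e₀ , e₁ = block0 x e in φ x , trans (+-comm _ 1) (sym s) , e₀ , e₁ , tt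
encodeL L01 l1 u x _ e = let s , e₀ , e₁ = block1 x e in φ x , trans (+-comm _ 1) (sym s) , e₀ , e₁ , tt
encodeL L01 l2 u x (ne , _) e = ⊥-elim (ne refl)

frame : Letter → Word → Letter → Word
frame a u b = a ∷ u ++ b ∷ []

image-frame : ∀ l u r b → image l u r ++ b ∷ [] ≡ pre l ++ h u ++ post r ++ b ∷ []
image-frame l u r b = trans (++-assoc (pre l) _ _) (cong (pre l ++_) (++-assoc (h u) _ _))

encode : ∀ l r a b u x → admissibleL l a u → admissibleR r b u → Occ (frame a u b) x →
  ∃ λ x′ → suc x′ + length (pre l) ≡ φ (suc x) × Occ (frame (imageL l a) (image l u r) (imageR r b)) x′
encode l r a b u x al ar (e , o) with encodeL l a u x al e
... | x′ , s , e′ , op = x′ , s , e′ , subst (λ w → Occ w (suc x′)) (sym (image-frame l u r _))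
  (Occ-++ (pre l) op (subst (Occ _) (sym s) (Occ-++ (h u) (Occ-h u ou)
    (subst (Occ _) (φ-+ u ou) (encodeR r b u (suc x + length u) ar (proj₁ (Occ-++ʳ u o)))))))
  where ou = Occ-++ˡ u o

h-head : ∀ u {v x} → 1 ≤ length u → Occ (h u ++ v) x → p x ≢ l1
h-head (l0 ∷ u) _ (e , _) = ≢-via e λ ()
h-head (l1 ∷ u) _ (e , _) = ≢-via e λ ()
h-head (l2 ∷ u) _ (e , _) = ≢-via e λ ()

decodeL : ∀ l r a b u x′ → admissibleL l a u → admissibleR r b u →
  Occ (imageL l a ∷ pre l ++ h u ++ post r ++ imageR r b ∷ []) x′ →
  ∃ λ x → suc x′ + length (pre l) ≡ φ (suc x) × Occ (frame a u b) x
decodeL L02 r a b u@(l1 ∷ _) x′ (ne , refl) ar (e , o) with first-≢1 (suc x′) (h-head u (s≤s z≤n) o)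
... | suc x , s = x , trans (+-identityʳ _) s , pa a ne e , o′
  where
  o′ = decodeR r b u (suc x) ar (subst (Occ _) s o)
  pa : ∀ a → a ≢ l1 → p x′ ≡ imageL L02 a → p x ≡ a
  pa a ne e with letter (p x)
  pa l0 ne e | inj₁ q = q
  pa l1 ne e | inj₁ q = ⊥-elim (ne refl)
  pa l2 ne e | inj₁ q = clash e (trans (cong p (suc-injective (trans s (proj₁ (block0 x q))))) (proj₂ (proj₂ (block0 x q)))) λ ()
  -- `u` starts with 1 and 11 does not occur, so the block in front is not h(1).
  pa a ne e | inj₂ (inj₁ q) = ⊥-elim (after1 x q (proj₁ o′))
  pa l0 ne e | inj₂ (inj₂ q) = clash e (trans (cong p (suc-injective (trans s (proj₁ (block2 x q))))) (proj₂ (block2 x q))) λ ()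
  pa l1 ne e | inj₂ (inj₂ q) = ⊥-elim (ne refl)
  pa l2 ne e | inj₂ (inj₂ q) = q
decodeL L01 r a b u x′ (ne , _) ar (e , e₁ , o) with second-≡1 (suc x′) e₁
... | x , refl , s , q≢2 = x , trans (+-comm _ 1) s , pa a ne e , decodeR r b u (suc x) ar (subst (Occ _) s o)
  where
  pa : ∀ a → a ≢ l2 → p x′ ≡ imageL L01 a → p x ≡ a
  pa a ne e with letter (p x)
  pa l0 ne e | inj₁ q = q
  pa l1 ne e | inj₁ q = clash e (proj₁ (proj₂ (block0 x q))) λ ()
  pa l2 ne e | _ = ⊥-elim (ne refl)
  pa l0 ne e | inj₂ (inj₁ q) = clash e (proj₁ (proj₂ (block1 x q))) λ ()
  pa l1 ne e | inj₂ (inj₁ q) = q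
  pa a ne e | inj₂ (inj₂ q) = ⊥-elim (q≢2 q)

ends-++ : ∀ r w a → ends r (a ∷ []) → ends r (w ++ a ∷ [])
ends-++ R∅ _ _ _ = tt
ends-++ R02 [] a e = e
ends-++ R12 [] a e = e
ends-++ R02 (_ ∷ []) a e = e
ends-++ R12 (_ ∷ []) a e = e
ends-++ R02 (_ ∷ w@(_ ∷ _)) a e = ends-++ R02 w a e
ends-++ R12 (_ ∷ w@(_ ∷ _)) a e = ends-++ R12 w a e

-- A forced 1 on the left makes the image start with 1, as `L02` asks; likewise a forced 0 on the
-- right makes it end in 0, as `R12` asks.
admissibleL-image : ∀ l r a u → admissibleL l a u → admissibleL (nextL l) (imageL l a) (image l u r)
admissibleL-image L02 r l0 (l1 ∷ u) _ = (λ ()) , s≤s z≤n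
admissibleL-image L02 r l1 (l1 ∷ u) (ne , _) = ⊥-elim (ne refl)
admissibleL-image L02 r l2 (l1 ∷ u) _ = (λ ()) , s≤s z≤n
admissibleL-image L01 r l0 u _ = (λ ()) , refl
admissibleL-image L01 r l1 u _ = (λ ()) , refl
admissibleL-image L01 r l2 u (ne , _) = ⊥-elim (ne refl)

admissibleR-image : ∀ l r b u → admissibleR r b u → admissibleR (nextR r) (imageR r b) (image l u r)
admissibleR-image l R02 l0 u _ = (λ ()) , subst (ends R12) (++-assoc (pre l) (h u) _) (ends-++ R12 (pre l ++ h u) l0 refl)
admissibleR-image l R02 l1 u ne = ⊥-elim (ne refl)
admissibleR-image l R02 l2 u _ = (λ ()) , subst (ends R12) (++-assoc (pre l) (h u) _) (ends-++ R12 (pre l ++ h u) l0 refl)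
admissibleR-image l R12 l0 u (ne , _) = ⊥-elim (ne refl)
admissibleR-image l R12 l1 u _ = λ ()
admissibleR-image l R12 l2 u _ = λ ()

length-frame : ∀ a u b → length (frame a u b) ≡ suc (suc (length u))
length-frame a u b = cong suc (trans (length-++ u) (+-comm (length u) 1))

-- An occurrence of the image strictly between the two would desubstitute, φ being increasing, to
-- one strictly between x and y.
consecutive-step : ∀ l r a b u x y → admissibleL l a u → admissibleR r b u → Consecutive (frame a u b) x y →
  ∃₂ λ x′ y′ → suc x′ + length (pre l) ≡ φ (suc x) × suc y′ + length (pre l) ≡ φ (suc y) ×
    Consecutive (frame (imageL l a) (image l u r) (imageR r b)) x′ y′
consecutive-step l r a b u x y al ar c
  with encode l r a b u x al ar (Consecutive.occ₁ c) | encode l r a b u y al ar (Consecutive.occ₂ c)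
... | x′ , sx , ox | y′ , sy , oy = x′ , y′ , sx , sy , record
  { occ₁ = ox
  ; occ₂ = oy
  ; ordered = s≤s⁻¹ (+-cancelʳ-< (length (pre l)) _ _ (subst₂ _<_ (sym sx) (sym sy) (φ-<-mono (s≤s ordered))))
  ; between = λ z′ x<z z<y oz →
      let z , sz , o = decodeL l r a b u z′ al ar (proj₁ oz , subst (λ w → Occ w (suc z′)) (image-frame l u r _) (proj₂ oz))
      in between z
        (s≤s⁻¹ (φ-<-cancel (subst₂ _<_ sx sz (+-monoˡ-< (length (pre l)) (s≤s x<z)))))
        (s≤s⁻¹ (φ-<-cancel (subst₂ _<_ sz sy (+-monoˡ-< (length (pre l)) (s≤s z<y)))))
        o
  }
  where open Consecutive c

frame-pre : ∀ l r a b u {x} → Occ (frame a (image l u r) b) x → Occ (pre l) (suc x)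
frame-pre l r a b u (_ , o) = Occ-++ˡ (pre l) (Occ-++ˡ (image l u r) o)

-- A frame starts one letter before its bispecial word, hence `suc x`. The equation gives the
-- distance y' - x' as `φ^ k (suc y)` minus `φ^ k (suc x)`.
consecutive : ∀ k l r a b u x y → admissibleL l a u → admissibleR r b u → Consecutive (frame a u b) x y →
  ∃ λ w → ∃₂ λ x′ y′ → length w ≡ suc (suc (Λ k u + er r k + el l k)) ×
    y′ + φ^ k (suc x) ≡ x′ + φ^ k (suc y) × Consecutive w x′ y′
consecutive zero l r a b u x y al ar c = frame a u b , x , y ,
  trans (length-frame a u b) (cong (λ n → suc (suc n)) (trans (sym (Λ-zero u)) (sym (trans (+-identityʳ _) (+-identityʳ _))))) ,
  trans (+-suc y x) (trans (cong suc (+-comm y x)) (sym (+-suc x y))) , c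
consecutive (suc k) l r a b u x y al ar c with consecutive-step l r a b u x y al ar c
... | x₁ , y₁ , sx , sy , c₁
  with consecutive k (nextL l) (nextR r) _ _ (image l u r) x₁ y₁
         (admissibleL-image l r a u al) (admissibleR-image l r b u ar) c₁
... | w , x₂ , y₂ , len , gap , c₂ = w , x₂ , y₂ , trans len (cong (λ n → suc (suc n)) length-eq) , gap′ , c₂
  where
  open ≡-Reasoning
  regroup : ∀ a b c d e → a + (b + c) + d + e ≡ b + (c + d) + (e + a)
  regroup = solve-∀
  length-eq : Λ k (image l u r) + er (nextR r) k + el (nextL l) k ≡ Λ (suc k) u + er r (suc k) + el l (suc k)
  length-eq = begin
    Λ k (image l u r) + er (nextR r) k + el (nextL l) k

        ≡⟨ cong (λ n → n + er (nextR r) k + el (nextL l) k) (trans (Λ-++ k (pre l) _) (cong (Λ k (pre l) +_) (Λ-++ k (h u) (post r)))) ⟩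
    Λ k (pre l) + (Λ k (h u) + Λ k (post r)) + er (nextR r) k + el (nextL l) k
      ≡⟨ regroup (Λ k (pre l)) (Λ k (h u)) (Λ k (post r)) (er (nextR r) k) _ ⟩
    Λ k (h u) + er r (suc k) + el l (suc k)
      ≡⟨ cong (λ n → n + er r (suc k) + el l (suc k)) (sym (Λ-suc k u)) ⟩
    Λ (suc k) u + er r (suc k) + el l (suc k) ∎
  image-end : ∀ z {z₁} → suc z₁ + length (pre l) ≡ φ (suc z) →
    Occ (frame (imageL l a) (image l u r) (imageR r b)) z₁ → φ^ (suc k) (suc z) ≡ φ^ k (suc z₁) + Λ k (pre l)
  image-end z s o = trans (cong (φ^ k) (sym s)) (φ^-+ k (pre l) (frame-pre l r _ _ u o))
  gap′ : y₂ + φ^ (suc k) (suc x) ≡ x₂ + φ^ (suc k) (suc y)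
  gap′ = begin
    y₂ + φ^ (suc k) (suc x)                  ≡⟨ cong (y₂ +_) (image-end x sx (Consecutive.occ₁ c₁)) ⟩
    y₂ + (φ^ k (suc x₁) + Λ k (pre l))       ≡⟨ sym (+-assoc y₂ _ _) ⟩
    y₂ + φ^ k (suc x₁) + Λ k (pre l)         ≡⟨ cong (_+ Λ k (pre l)) gap ⟩
    x₂ + φ^ k (suc y₁) + Λ k (pre l)         ≡⟨ +-assoc x₂ _ _ ⟩
    x₂ + (φ^ k (suc y₁) + Λ k (pre l))       ≡⟨ cong (x₂ +_) (sym (image-end y sy (Consecutive.occ₂ c₁))) ⟩
    x₂ + φ^ (suc k) (suc y)                  ∎

occ? : ∀ w x → Dec (Occ w x)
occ? [] x = yes tt
occ? (a ∷ w) x = p x Fin.≟ a ×-dec occ? w (suc x)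

Separates : Word → ℕ → ℕ → Set
Separates w x y = Occ w x × Occ w y × (∀ {z} → z < y → x < z → ¬ Occ w z)

separates? : ∀ w x y → Dec (Separates w x y)
separates? w x y = occ? w x ×-dec occ? w y ×-dec allUpTo? (λ z → (x <? z) →-dec ¬? (occ? w z)) y

separates-consecutive : ∀ {w x y} → x < y → Separates w x y → Consecutive w x y
separates-consecutive x<y (o , o′ , f) = record { occ₁ = o ; occ₂ = o′ ; ordered = x<y ; between = λ z x<z z<y → f z<y x<z }

-- X, B and C in terms of block lengths

-- The lengths |h^k(0)| satisfy the recurrence of X: unfolded to level k, both sides are the same
-- combination of the three block lengths.
X-ℓ : ∀ k → X (suc k) ≡ ℓ k l0
X-ℓ 0 = refl
X-ℓ 1 = refl
X-ℓ 2 = refl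
X-ℓ 3 = refl
X-ℓ (suc (suc (suc (suc k)))) =
  trans (cong₂ _+_ (cong₂ _+_ (X-ℓ (suc (suc (suc k)))) (X-ℓ (suc (suc k)))) (X-ℓ k)) (expand (ℓ k l0) (ℓ k l1) (ℓ k l2))
  where
  expand : ∀ a b c → (a + b + (c + b) + (a + (c + b))) + (a + b + (c + b)) + a ≡
    a + b + (c + b) + (a + (c + b)) + (a + b + (a + (c + b)))
  expand = solve-∀

Λ-hIter : ∀ m k → Λ k (hIter m) ≡ X (suc (m + k))
Λ-hIter zero k = trans (+-identityʳ _) (sym (X-ℓ k))
Λ-hIter (suc m) k = trans (sym (Λ-suc k (hIter m))) (trans (Λ-hIter m (suc k)) (cong (λ n → X (suc n)) (+-suc m k)))

Λ-V₁ : ∀ k → Λ k V₁ ≡ X (5 + k)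
Λ-V₁ k = Λ-hIter 4 k

Λ-V₂ : ∀ k → Λ k V₂ ≡ X (5 + k) + X (3 + k)
Λ-V₂ k = trans (Λ-++ k (hIter 4) (hIter 2)) (cong₂ _+_ (Λ-hIter 4 k) (Λ-hIter 2 k))

-- Two applications of h restore the neighbour constraints. The increment is what one more 01 adds
-- to the digits of B.
N₂-step : ∀ k → N₂ (2 + k) ≡ X (4 + k) + N₂ k
N₂-step k = trans (expand (ℓ k l0) (ℓ k l1) (ℓ k l2) (er R12 k) (el L02 k)) (cong (_+ N₂ k) (sym (X-ℓ (3 + k))))
  where
  expand : ∀ a b c r l → (a + (c + b)) + (a + b + (c + b) + 0) + (a + 0 + r) + (l + (b + 0) + 0) ≡
    (a + b + (c + b) + (a + (c + b))) + (b + (a + 0) + r + l)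
  expand = solve-∀

N₁-half-step : ∀ k → N₁ (2 + k) ≡ ℓ (2 + k) l1 + ℓ (1 + k) l0 + N₁ k
N₁-half-step k = expand (ℓ k l0) (ℓ k l1) (ℓ k l2) (er R02 k) (el L02 k)
  where
  expand : ∀ a b c r l → (a + (c + b)) + 0 + (a + b + 0 + r) + (l + (b + 0) + 0) ≡
    (a + (c + b)) + (a + b) + (b + 0 + r + l)
  expand = solve-∀

-- Two half steps add up to a single X, the contribution of one more 0010 to the digits of C.
N₁-step : ∀ k → N₁ (4 + k) ≡ X (6 + k) + N₁ k
N₁-step k = begin
  N₁ (4 + k)                                                        ≡⟨ N₁-half-step (2 + k) ⟩
  ℓ (4 + k) l1 + ℓ (3 + k) l0 + N₁ (2 + k)
    ≡⟨ cong (ℓ (4 + k) l1 + ℓ (3 + k) l0 +_) (N₁-half-step k) ⟩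
  ℓ (4 + k) l1 + ℓ (3 + k) l0 + (ℓ (2 + k) l1 + ℓ (1 + k) l0 + N₁ k)
    ≡⟨ regroup (ℓ (4 + k) l1) (ℓ (3 + k) l0) (ℓ (2 + k) l1) (ℓ (1 + k) l0) (N₁ k) ⟩
  ℓ (5 + k) l0 + N₁ k                                               ≡⟨ cong (_+ N₁ k) (sym (X-ℓ (5 + k))) ⟩
  X (6 + k) + N₁ k                                                  ∎
  where
  open ≡-Reasoning
  regroup : ∀ a b c d e → a + b + (c + d + e) ≡ b + (d + c) + a + e
  regroup = solve-∀

length-rep : ∀ i w v → length (rep i w ++ v) ≡ i * length w + length v
length-rep zero w v = refl
length-rep (suc i) w v = begin
  length ((w ++ rep i w) ++ v)              ≡⟨ cong length (++-assoc w (rep i w) v) ⟩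
  length (w ++ rep i w ++ v)                ≡⟨ length-++ w ⟩
  length w + length (rep i w ++ v)          ≡⟨ cong (length w +_) (length-rep i w v) ⟩
  length w + (i * length w + length v)      ≡⟨ sym (+-assoc (length w) _ _) ⟩
  length w + i * length w + length v        ∎
  where open ≡-Reasoning

valP-01 : ∀ w → valP (1 ∷ 0 ∷ 1 ∷ w) ≡ X (3 + length w) + valP (1 ∷ w)
valP-01 w = cong (_+ valP (1 ∷ w)) (*-identityˡ (X (3 + length w)))

valP-0010 : ∀ w → valP (1 ∷ 0 ∷ 0 ∷ 0 ∷ 1 ∷ 0 ∷ w) ≡ X (6 + length w) + valP (1 ∷ 0 ∷ w)
valP-0010 w = cong (_+ valP (1 ∷ 0 ∷ w)) (*-identityˡ (X (6 + length w)))

valP-Bodd : ∀ q → valP (Bodd q) ≡ 2 + N₂ (1 + q * 2)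
valP-Bodd zero = refl
valP-Bodd (suc q) = begin
  valP (Bodd (suc q))                          ≡⟨ valP-01 (rep q (0 ∷ 1 ∷ []) ++ 1 ∷ 0 ∷ []) ⟩
  X (3 + length (rep q (0 ∷ 1 ∷ []) ++ 1 ∷ 0 ∷ [])) + valP (Bodd q)

                                                 ≡⟨ cong₂ (λ n m → X (3 + n) + m) (trans (length-rep q _ _) (+-comm (q * 2) 2)) (valP-Bodd q) ⟩
  X (5 + q * 2) + (2 + N₂ (1 + q * 2))         ≡⟨ regroup (X (5 + q * 2)) _ ⟩
  2 + (X (5 + q * 2) + N₂ (1 + q * 2))         ≡⟨ cong (2 +_) (sym (N₂-step (1 + q * 2))) ⟩
  2 + N₂ (3 + q * 2)                           ∎
  where
  open ≡-Reasoning
  regroup : ∀ a b → a + (2 + b) ≡ 2 + (a + b)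
  regroup = solve-∀

valP-Beven : ∀ q → valP (Beven q) ≡ 2 + N₂ (2 + q * 2)
valP-Beven zero = refl
valP-Beven (suc q) = begin
  valP (Beven (suc q))                         ≡⟨ valP-01 ((rep q (0 ∷ 1 ∷ []) ++ 1 ∷ 0 ∷ []) ++ 0 ∷ []) ⟩
  X (3 + length ((rep q (0 ∷ 1 ∷ []) ++ 1 ∷ 0 ∷ []) ++ 0 ∷ [])) + valP (Beven q)

                                                 ≡⟨ cong₂ (λ n m → X (3 + n) + m) (trans (cong length (++-assoc (rep q (0 ∷ 1 ∷ [])) _ _)) (trans (length-rep q _ _) (+-comm (q * 2) 3))) (valP-Beven q) ⟩
  X (6 + q * 2) + (2 + N₂ (2 + q * 2))         ≡⟨ regroup (X (6 + q * 2)) _ ⟩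
  2 + (X (6 + q * 2) + N₂ (2 + q * 2))         ≡⟨ cong (2 +_) (sym (N₂-step (2 + q * 2))) ⟩
  2 + N₂ (4 + q * 2)                           ∎
  where
  open ≡-Reasoning
  regroup : ∀ a b → a + (2 + b) ≡ 2 + (a + b)
  regroup = solve-∀

Cword : ℕ → List ℕ → List ℕ
Cword q w = 1 ∷ 0 ∷ rep q (0 ∷ 0 ∷ 1 ∷ 0 ∷ []) ++ w

valP-Cword : ∀ w → valP (1 ∷ 0 ∷ w) ≡ 1 + N₁ (length w) → ∀ q → valP (Cword q w) ≡ 1 + N₁ (length w + q * 4)
valP-Cword w e zero = trans e (cong (λ n → 1 + N₁ n) (sym (+-identityʳ (length w))))
valP-Cword w e (suc q) = begin
  valP (Cword (suc q) w)                       ≡⟨ valP-0010 (rep q (0 ∷ 0 ∷ 1 ∷ 0 ∷ []) ++ w) ⟩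
  X (6 + length (rep q (0 ∷ 0 ∷ 1 ∷ 0 ∷ []) ++ w)) + valP (Cword q w)

                                                 ≡⟨ cong₂ (λ n m → X (6 + n) + m) (trans (length-rep q _ _) (+-comm (q * 4) (length w))) (valP-Cword w e q) ⟩
  X (6 + j) + (1 + N₁ j)                       ≡⟨ +-suc (X (6 + j)) (N₁ j) ⟩
  1 + (X (6 + j) + N₁ j)                       ≡⟨ cong suc (sym (N₁-step j)) ⟩
  1 + N₁ (4 + j)                               ≡⟨ cong (λ n → 1 + N₁ n) (shift (length w) (q * 4)) ⟩
  1 + N₁ (length w + (4 + q * 4))              ∎
  where
  open ≡-Reasoning
  j = length w + q * 4
  shift : ∀ a b → 4 + (a + b) ≡ a + (4 + b)
  shift = solve-∀

B-odd : ∀ q → B (3 + q * 2) ≡ 2 + N₂ (1 + q * 2)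
B-odd q = trans (cong (λ r → Bsel r (3 + q * 2)) ([m+kn]%n≡m%n 3 q 2))
  (trans (cong (λ i → valP (Bodd i)) (m*n/n≡m q 2)) (valP-Bodd q))

B-even : ∀ q → B (4 + q * 2) ≡ 2 + N₂ (2 + q * 2)
B-even q = trans (cong (λ r → Bsel r (4 + q * 2)) ([m+kn]%n≡m%n 4 q 2))
  (trans (cong (λ i → valP (Beven i)) (m*n/n≡m q 2)) (valP-Beven q))

B-N₂ : ∀ k → B (3 + k) ≡ 2 + N₂ (1 + k)
B-N₂ k with k % 2 | m%n<n k 2 | m≡m%n+[m/n]*n k 2
... | 0 | _ | e = subst (λ k → B (3 + k) ≡ 2 + N₂ (1 + k)) (sym e) (B-odd (k / 2))
... | 1 | _ | e = subst (λ k → B (3 + k) ≡ 2 + N₂ (1 + k)) (sym e) (B-even (k / 2))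
... | suc (suc _) | s≤s (s≤s ()) | _

Ctail-N₁ : ∀ r → r < 4 → length (Ctail r) ≡ r × valP (1 ∷ 0 ∷ Ctail r) ≡ 1 + N₁ (length (Ctail r))
Ctail-N₁ 0 _ = refl , refl
Ctail-N₁ 1 _ = refl , refl
Ctail-N₁ 2 _ = refl , refl
Ctail-N₁ 3 _ = refl , refl
Ctail-N₁ (suc (suc (suc (suc _)))) (s≤s (s≤s (s≤s (s≤s ()))))

C-N₁ : ∀ k → C (2 + k) ≡ 1 + N₁ k
C-N₁ k with Ctail-N₁ (k % 4) (m%n<n k 4)
... | len , e = trans (valP-Cword (Ctail (k % 4)) e (k / 4))
  (cong (λ n → 1 + N₁ n) (trans (cong (_+ k / 4 * 4) len) (sym (m≡m%n+[m/n]*n k 4))))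

-- The values of R

-- Minimality is tested at x alone: a recurrence within m' < m would put an occurrence of `w`
-- strictly between x and y.
isR : ∀ {n N m w x y} → 1 ≤ m → (∀ i → Recurs i N m) → n ≤ N →
  Consecutive w x y → length w ≤ n → x + m ≤ y → IsR n m
isR {n} {N} {m} {w} {x} {y} 1≤m rec n≤N c w≤n x+m≤y = 1≤m , recurrent , minimal
  where
  open Consecutive c
  recurrent : Recurrent n m
  recurrent i with rec i
  ... | j , i<j , j≤ , f = j , i<j , j≤ , λ k k<n → f k (<-≤-trans k<n n≤N)
  minimal : ∀ m′ → 1 ≤ m′ → m′ < m → ¬ Recurrent n m′
  minimal m′ _ m′<m r with r x
  ... | j , x<j , j≤ , f = between j x<j (<-≤-trans (≤-<-trans j≤ (+-monoʳ-< x m′<m)) x+m≤y)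
    (match-Occ w occ₁ (λ k k<w → f k (<-≤-trans k<w w≤n)))

-- `t` leads from one bispecial word to the next, so at level k the occurrences are |h^k(t)| ≥
-- |h^k(v)| = m apart.
isR-lift : ∀ {n N m v} k r a b u t x y → admissibleL L02 a u → admissibleR r b u → Consecutive (frame a u b) x y →
  Occ t (suc x) → x + length t ≡ y → v ≼ t → m ≡ Λ k v → 1 ≤ m → (∀ i → Recurs i N m) → n ≤ N →
  2 + (Λ k u + er r k + el L02 k) ≤ n → IsR n m
isR-lift {v = v} k r a b u t x y al ar c ot refl v≼t refl 1≤m rec n≤N ≤n
  with consecutive k L02 r a b u x y al ar c
... | w , x′ , y′ , len , gap , c′ = isR 1≤m rec n≤N c′ (≤-trans (≤-reflexive len) ≤n)
  (≤-trans (+-monoʳ-≤ x′ (Λ-mono k v t v≼t)) (≤-reflexive (sym (+-cancelʳ-≡ (φ^ k (suc x)) y′ _ (begin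
    y′ + φ^ k (suc x)                     ≡⟨ gap ⟩
    x′ + φ^ k (suc x + length t)          ≡⟨ cong (x′ +_) (φ^-+ k t ot) ⟩
    x′ + (φ^ k (suc x) + Λ k t)           ≡⟨ swap x′ (φ^ k (suc x)) (Λ k t) ⟩
    x′ + Λ k t + φ^ k (suc x)             ∎)))))
  where
  open ≡-Reasoning
  swap : ∀ a b c → a + (b + c) ≡ a + c + b
  swap = solve-∀

X-pos : ∀ k → 1 ≤ X (suc k)
X-pos k = subst (1 ≤_) (sym (X-ℓ k)) (ℓ-pos k l0)

consecutive-2102 : Consecutive (frame l2 (l1 ∷ l0 ∷ []) l2) 2 23
consecutive-2102 = separates-consecutive (from-yes (2 <? 23)) (from-yes (separates? (frame l2 (l1 ∷ l0 ∷ []) l2) 2 23))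

consecutive-010 : Consecutive (frame l0 (l1 ∷ []) l0) 16 32
consecutive-010 = separates-consecutive (from-yes (16 <? 32)) (from-yes (separates? (frame l0 (l1 ∷ []) l0) 16 32))

-- Both bounds equal |h^(k+5)(0)|: the lower one is h⁵(0) lifted k times, the upper one h⁴(0) lifted
-- k + 1 times.
isR-X : ∀ k n → 2 + N₂ k ≤ n → n ≤ 1 + N₁ (1 + k) → IsR n (X (6 + k))
isR-X k n N₂<n n≤N₁ = isR-lift {v = hIter 5} k R12 l2 l2 (l1 ∷ l0 ∷ []) (take 21 (drop 3 (hIter 6))) 2 23
  ((λ ()) , refl) ((λ ()) , refl) consecutive-2102 (from-yes (occ? (take 21 (drop 3 (hIter 6))) 3)) refl
  (from-yes (hIter 5 ≼? take 21 (drop 3 (hIter 6)))) (sym (Λ-hIter 5 k)) (X-pos (5 + k))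
  (λ i → subst (Recurs i _) (trans (Λ-V₁ (1 + k)) (cong X (+-suc 5 k))) (recurrent₁ (1 + k) i)) n≤N₁ N₂<n

isR-X+X : ∀ k n → 2 + N₁ k ≤ n → n ≤ 1 + N₂ k → IsR n (X (5 + k) + X (3 + k))
isR-X+X k n N₁<n n≤N₂ = isR-lift {v = V₂} k R02 l0 l0 (l1 ∷ []) (take 16 (drop 17 (hIter 6))) 16 32
  ((λ ()) , refl) (λ ()) consecutive-010 (from-yes (occ? (take 16 (drop 17 (hIter 6))) 17)) refl
  (from-yes (V₂ ≼? take 16 (drop 17 (hIter 6)))) (sym (Λ-V₂ k)) (m≤n⇒m≤n+o _ (X-pos (4 + k)))
  (λ i → subst (Recurs i _) (Λ-V₂ k) (recurrent₂ k i)) n≤N₂ N₁<n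

-- Every letter recurs after at most two 0s, two 1s and one 2, hence within 5 = R(1).
V₀ : Word
V₀ = l0 ∷ l0 ∷ l1 ∷ l1 ∷ l2 ∷ []

opaque
  unfolding windows

  returns₀ : ∀ a → Returns V₀ (a ∷ [])
  returns₀ = from-yes (Fin.all? λ a → returns? V₀ (a ∷ []))

recurrent₀ : ∀ i → Recurs i 1 5
recurrent₀ i with return V₀ (p i ∷ []) (returns₀ (p i)) {i} (refl , tt)
... | o , u , pos , u≼ , _ , o′ = i + length u , m<m+n i pos ,
  +-monoʳ-≤ i (subst (_≤ 5) (Λ-zero u) (Λ-mono 0 u V₀ u≼)) , Occ-match (p i ∷ []) {i} {i + length u} o o′

isR-1 : IsR 1 5
isR-1 = isR (s≤s z≤n) recurrent₀ ≤-refl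
  (separates-consecutive (from-yes (5 <? 10)) (from-yes (separates? (l2 ∷ []) 5 10))) ≤-refl ≤-refl

isR-2 : IsR 2 12
isR-2 = isR (s≤s z≤n) (recurrent₁ 0) ≤-refl
  (separates-consecutive (from-yes (1 <? 13)) (from-yes (separates? (l1 ∷ l2 ∷ []) 1 13))) ≤-refl ≤-refl

theorem9 : IsR 1 5 × IsR 2 12 × IsR 3 16 × IsR 4 21 × IsR 5 28 ×
    (∀ i → 3 ≤ i →
    (∀ n → B i ≤ n → n ≤ C (suc i) → IsR n (X (i + 4))) ×
    (∀ n → C (suc i) < n → n < B (suc i) → IsR n (X (i + 4) + X (i + 2))))
theorem9 = isR-1 , isR-2 ,
  -- For n = 3, 4, 5 the levels are 0, 0, 1, and each range consists of this n alone.
  isR-X+X 0 3 ≤-refl ≤-refl ,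
  isR-X 0 4 ≤-refl ≤-refl ,
  isR-X+X 1 5 ≤-refl ≤-refl ,
  general
  where
  general : ∀ i → 3 ≤ i →
    (∀ n → B i ≤ n → n ≤ C (suc i) → IsR n (X (i + 4))) ×
    (∀ n → C (suc i) < n → n < B (suc i) → IsR n (X (i + 4) + X (i + 2)))
  general (suc (suc zero)) (s≤s (s≤s ()))
  general (suc zero) (s≤s ())
  general (suc (suc (suc j))) _ = bounded , gap
    where
    bounded : ∀ n → B (3 + j) ≤ n → n ≤ C (4 + j) → IsR n (X (3 + j + 4))
    bounded n B≤ ≤C = subst (λ m → IsR n (X m)) (+-comm 4 (3 + j))
      -- With i = 3 + j, the level is i - 2 here and i - 1 in `gap`.
      (isR-X (1 + j) n (subst (_≤ n) (B-N₂ j) B≤) (subst (n ≤_) (C-N₁ (2 + j)) ≤C))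
    gap : ∀ n → C (4 + j) < n → n < B (4 + j) → IsR n (X (3 + j + 4) + X (3 + j + 2))
    gap n C< <B = subst₂ (λ l m → IsR n (X l + X m)) (+-comm 4 (3 + j)) (+-comm 2 (3 + j))
      (isR-X+X (2 + j) n (subst (_< n) (C-N₁ (2 + j)) C<) (s≤s⁻¹ (subst (n <_) (B-N₂ (1 + j)) <B)))
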